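{- Let $x,y,z,\beta$ be indeterminates. Then, as formal power series in $u$, $$\sum_{n\ge0}F^{\mathrm{inv}}_n(q;x,y,z\,|\,\beta)\frac{u^n}{(q;q)_n}=\prod_{k=0}^{\infty}\frac{1-x^{ -1}y\,e_q\big((x-y)uq^{k+1}\big)}{1-\beta uq^k(z-y)-x^{ -1}y\big(1+\beta uq^k(x-z)\big)e_q\big((x-y)uq^{k+1}\big)}.$$
   Context: $(a;q)_n=\prod_{j=0}^{n-1}(1-aq^j)$ and $e_q(u)=\sum_{n\ge0}\frac{u^n}{(q;q)_n}$. For a permutation $\sigma=\sigma_1\cdots\sigma_n$ of $[n]=\{1,\dots,n\}$ set $\sigma_0=\sigma_{n+1}=0$; an index $0\le i\le n$ is a descent if $\sigma_i>\sigma_{i+1}$ and an ascent otherwise; $\mathrm{des}(\sigma)$ is the number of descents. $\mathrm{inv}(\sigma)=\#\{(i,j):i<j,\ \sigma_i>\sigma_j\}$. An entry $\sigma_i$ ($1\le i\le n$) is a right-to-left minimum if $\sigma_i<\sigma_j$ for all $j>i$; $\mathrm{RLmin}(\sigma)$ is their number. Place a bar at the beginning of $\sigma$ and immediately after each right-to-left minimum; this cuts $\sigma$ into blocks, and an entry is isolated if it alone forms a block; $\mathrm{isol}(\sigma)$ is the number of isolated entries. An index $0\le i\le n-1$ is a non-isolated ascent if it is an ascent and $\sigma_{i+1}$ is not isolated; $\mathrm{iasc}(\sigma)$ is their number. For $n\ge1$, $F^{\mathrm{inv}}_n(q;x,y,z|\beta)=\sum_{\sigma\in\mathfrak{S}_n}q^{\mathrm{inv}(\sigma)}x^{\mathrm{iasc}(\sigma)}z^{\mathrm{isol}(\sigma)}y^{\mathrm{des}(\sigma)-1}\beta^{\mathrm{RLmin}(\sigma)}$,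 and $F^{\mathrm{inv}}_0=1$. -}

module Defs where

open import Algebra.Bundles using (CommutativeRing)
open import Data.Nat using (ℕ; zero; suc; _∸_; _<ᵇ_; _≡ᵇ_) renaming (_*_ to _*ℕ_)
open import Data.Bool using (Bool; true; false; if_then_else_; not; _∧_)
open import Data.List using (List; []; _∷_; _++_; map; concatMap; foldr; length)

-- Permutations of [n] = {1,…,n}, as lists of natural numbers
-- (one-line notation σ₁ σ₂ … σₙ), enumerated by inserting n into
-- every position of each permutation of [n-1].

insertEverywhere : ℕ → List ℕ → List (List ℕ)
insertEverywhere a [] = (a ∷ []) ∷ []
insertEverywhere a (b ∷ bs) = (a ∷ b ∷ bs) ∷ map (b ∷_) (insertEverywhere a bs)

perms : ℕ → List (List ℕ)
perms zero = [] ∷ []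
perms (suc n) = concatMap (insertEverywhere (suc n)) (perms n)

count : List Bool → ℕ
count [] = 0
count (true ∷ bs) = suc (count bs)
count (false ∷ bs) = count bs

allB : (ℕ → Bool) → List ℕ → Bool
allB p [] = true
allB p (b ∷ bs) = p b ∧ allB p bs

inv : List ℕ → ℕ
inv [] = 0
inv (a ∷ as) = count (map (λ b → b <ᵇ a) as) Data.Nat.+ inv as

adjDesc : List ℕ → ℕ
adjDesc [] = 0
adjDesc (a ∷ []) = 0
adjDesc (a ∷ b ∷ bs) = (if b <ᵇ a then 1 else 0) Data.Nat.+ adjDesc (b ∷ bs)

des : List ℕ → ℕ
des σ = adjDesc (0 ∷ σ ++ (0 ∷ []))

rlFlags : List ℕ → List Bool
rlFlags [] = []
rlFlags (a ∷ as) = allB (λ b → a <ᵇ b) as ∷ rlFlags as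

RLmin : List ℕ → ℕ
RLmin σ = count (rlFlags σ)

-- isolated entries: bars at the beginning and right after each
-- right-to-left minimum; σᵢ is isolated iff there is a bar right before
-- it (i = 1 or σᵢ₋₁ is a RL-minimum) and right after it (σᵢ is a RL-min).
isolAux : Bool → List Bool → List Bool
isolAux prevBar [] = []
isolAux prevBar (f ∷ fs) = (prevBar ∧ f) ∷ isolAux f fs

isolFlags : List ℕ → List Bool
isolFlags σ = isolAux true (rlFlags σ)

isol : List ℕ → ℕ
isol σ = count (isolFlags σ)

-- non-isolated ascents: indices i ∈ {0,…,n-1} (σ₀ = 0) with
-- σᵢ < σᵢ₊₁ (not a descent) and σᵢ₊₁ not isolated.
iascAux : ℕ → List ℕ → List Bool → ℕ
iascAux prev [] _ = 0
iascAux prev (a ∷ as) [] = 0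
iascAux prev (a ∷ as) (iso ∷ isos) =
  (if not (a <ᵇ prev) ∧ not iso then 1 else 0) Data.Nat.+ iascAux a as isos

iasc : List ℕ → ℕ
iasc σ = iascAux 0 σ (isolFlags σ)

module SeriesOps {a} {A : Set a}
  (_⊕_ _⊗_ : A → A → A) (neg : A → A) (zero# : A) where

  infixl 6 _⊞_
  infixl 7 _⊠_
  infix 8 ⊟_

  Series : Set a
  Series = ℕ → A

  sumTo : (ℕ → A) → ℕ → A
  sumTo f zero = zero#
  sumTo f (suc n) = sumTo f n ⊕ f n

  _⊞_ : Series → Series → Series
  (f ⊞ g) n = f n ⊕ g n

  ⊟_ : Series → Series
  (⊟ f) n = neg (f n)

  _⊠_ : Series → Series → Series
  (f ⊠ g) n = sumTo (λ i → f i ⊗ g (n ∸ i)) (suc n)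

  private
    dot : Series → List A → A
    dot g [] = zero#
    dot g (b ∷ bs) = (g 0 ⊗ b) ⊕ dot (λ i → g (suc i)) bs

    -- [b_m , … , b_0] for b = f⁻¹, given c = (f 0)⁻¹
    invRev : Series → A → ℕ → List A
    invRev f c zero = c ∷ []
    invRev f c (suc m) =
      neg (c ⊗ dot (λ i → f (suc i)) (invRev f c m)) ∷ invRev f c m

    headOr : List A → A
    headOr [] = zero#
    headOr (b ∷ _) = b

  -- multiplicative inverse of a series f, given an inverse c of its
  -- constant term f 0:  b₀ = c, b_m = - c · Σ_{j=1}^{m} f_j b_{m-j}
  invS : Series → A → Series
  invS f c m = headOr (invRev f c m)

-- The objects of Theorem 5.2 over a commutative ring R.
-- R[[q]] : ℕ → Carrier ;  R[[q]][[u]] : ℕ → (ℕ → Carrier),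
-- where  G n m  is the coefficient of uⁿ qᵐ.

module Thm {c ℓ} (R : CommutativeRing c ℓ) where
  open CommutativeRing R

  pow : Carrier → ℕ → Carrier
  pow a zero = 1#
  pow a (suc n) = a * pow a n

  module Q = SeriesOps _+_ _*_ -_ 0#

  QS : Set c
  QS = ℕ → Carrier

  constQ : Carrier → QS
  constQ r zero = r
  constQ r (suc _) = 0#

  0Q 1Q : QS
  0Q _ = 0#
  1Q = constQ 1#

  qmono : Carrier → ℕ → QS
  qmono r e m = if m ≡ᵇ e then r else 0#

  module U = SeriesOps Q._⊞_ Q._⊠_ Q.⊟_ 0Q

  BS : Set c
  BS = ℕ → QS

  constB : Carrier → BS
  constB r zero = constQ r
  constB r (suc _) = 0Q

  1B : BS
  1B = constB 1#

  umono : Carrier → ℕ → BS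
  umono r k zero = 0Q
  umono r k (suc zero) = qmono r k
  umono r k (suc (suc _)) = 0Q

  qPoch : ℕ → QS
  qPoch zero = 1Q
  qPoch (suc n) = qPoch n Q.⊠ (1Q Q.⊞ qmono (- 1#) (suc n))

  -- 1/(q;q)ₙ  (constant term of (q;q)ₙ is 1)
  invQPoch : ℕ → QS
  invQPoch n = Q.invS (qPoch n) 1#

  eq : BS
  eq n = invQPoch n

  substU : Carrier → ℕ → BS → BS
  substU r s F n = qmono (pow r n) (s *ℕ n) Q.⊠ F n

  weight : (x y z β : Carrier) → List ℕ → QS
  weight x y z β σ =
    qmono (pow x (iasc σ) * pow z (isol σ) * pow y (des σ ∸ 1) * pow β (RLmin σ))
          (inv σ)

  Finv : (x y z β : Carrier) → ℕ → QS
  Finv x y z β zero = 1Q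
  Finv x y z β (suc n) = foldr (λ σ acc → weight x y z β σ Q.⊞ acc) 0Q (perms (suc n))

  LHS : (x y z β : Carrier) → BS
  LHS x y z β n = Finv x y z β n Q.⊠ invQPoch n

  -- k-th factor of the product; xinv = x⁻¹, dinv = (x - y)⁻¹, so that
  -- (1 - x⁻¹y)⁻¹ = x · dinv is the inverse of the constant term of the
  -- denominator.
  module _ (x y z β xinv dinv : Carrier) where
    E : ℕ → BS
    E k = substU (x + - y) (suc k) eq

    Num : ℕ → BS
    Num k = 1B U.⊞ (U.⊟ (constB (xinv * y) U.⊠ E k))

    Den : ℕ → BS
    Den k = 1B U.⊞ (U.⊟ (umono (β * (z + - y)) k))
               U.⊞ (U.⊟ ((constB (xinv * y) U.⊠ (1B U.⊞ umono (β * (x + - z)) k)) U.⊠ E k))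

    factor : ℕ → BS
    factor k = Num k U.⊠ U.invS (Den k) (Q.invS (Den k 0) (x * dinv))

    prodTo : ℕ → BS
    prodTo zero = 1B
    prodTo (suc K) = prodTo K U.⊠ factor K

module Submission where

-- Write G for the left-hand side, E = e_q((x-y)u), and a prime for u ↦ uq.
-- The k-th factor is f(uqᵏ) with f = N/D, so it suffices to prove D G = N G′: then
-- the first K factors multiply to G(u)/G(uqᴷ), and G(uqᴷ) ≡ 1 modulo q^K.
--
-- Cutting a permutation at its smallest entry, σ = τ 1 ρ, all statistics are additive
-- up to the inversions between τ and ρ, which account for a q-binomial coefficient.
-- Let C be the q-exponential generating function of the words 0 ρ 0 weighted by
-- inversions (q), ascents (x) and descents (y), the empty word having weight y.
-- The cut gives, with p = x-y,
--   C = C′ + u (C′ + p) C   and   G = G′ + β u (C′ + z-y) G.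
-- Both x C and y E (C + p) solve f = f′ + u (C′ + p) f with the same constant term, so
-- they agree because every 1-qⁿ with n ≥ 1 is invertible.  Eliminating C′ between
-- x C′ = y E′ (C′ + p) and the equation for G yields D G = N G′.

-- The terms `p` = x-y and z-y correct the empty prefix. For nonempty τ the step from τ down to 1 is
-- a descent, like the step to the final 0 in 0 τ 0, so τ contributes its full weight in C; the q in
-- C(uq) records the inversions of τ with 1. An empty τ has weight y in C, but in the recurrence for
-- C the step 0 → 1 is then an ascent of weight x, and in the one for G the entry 1 is isolated and
-- has weight z.
--
-- The obstacle is that permutations are generated by inserting the largest entry, whereas the cut
-- at the smallest leaves words on arbitrary subsets of labels. Instead of standardizing them,
-- permutations are enumerated over any decreasing list of labels, and the sum of a weight is shown
-- to depend only on the number of labels, by induction along the recurrence itself. The q-binomial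
-- coefficients are never written out: the largest label goes to the left or right of the cut, which
-- is the q-Pascal rule, and this rule matches the q-Leibniz rule for products of series.

open import Defs
open import Algebra.Bundles using (CommutativeRing)
open import Data.Bool using (Bool; true; false; if_then_else_; not; _∧_)
open import Data.Bool.Properties using (∧-zeroʳ)
open import Data.List using (List; []; _∷_; _++_; _∷ʳ_; map; concatMap; foldr; length; applyDownFrom; initLast; _∷ʳ′_)
open import Data.List.Properties using
  (map-++; map-∘; concatMap-cong; concatMap-map; map-concatMap; ++-assoc; length-++; length-applyDownFrom)
open import Data.List.Relation.Binary.Sublist.Propositional using (_⊆_; []; _∷_) renaming (_∷ʳ_ to skip)
import Data.List.Relation.Binary.Sublist.Heterogeneous.Properties as Sublistₚ
open import Data.List.Relation.Binary.Sublist.Propositional.Properties using (All-resp-⊆)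
open import Data.List.Relation.Unary.All as All using (All; []; _∷_)
import Data.List.Relation.Unary.All.Properties as Allₚ
open import Data.List.Relation.Unary.AllPairs using (AllPairs; []; _∷_)
import Data.List.Relation.Unary.AllPairs.Properties as AllPairsₚ
open import Data.Nat using (ℕ; zero; suc; _∸_; _≤_; _<_; _>_; z≤n; s≤s; _<ᵇ_)
import Data.Nat as ℕ
import Data.Nat.Properties as ℕₚ
open import Data.Product using (_×_; _,_; proj₁; proj₂; ∃-syntax)
open import Data.Sum using (inj₁; inj₂)
open import Function using (_∘_)
open import Relation.Binary.PropositionalEquality as ≡ using (_≡_)
import Algebra.Properties.CommutativeSemigroup
import Algebra.Properties.Group
import Algebra.Properties.Ring
import Algebra.Solver.Ring.NaturalCoefficients.Default
import Relation.Binary.Reasoning.Setoid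

-- Formal power series

module FormalInverse {a} {A : Set a}
  (_⊕_ _⊗_ : A → A → A) (neg : A → A) (zero# : A) where
  open SeriesOps _⊕_ _⊗_ neg zero#

  -- The partial sums Σ_{i≤m} g i ⊗ b_{m-i} by which invS computes its
  -- coefficients b are private to Defs.  The with-abstraction decouples g from
  -- f, so that unification can read off the definition of partialDot.
  mutual
    partialDot : Series → Series → A → ℕ → A
    partialDot = _

    invS-suc : ∀ f c m →
      invS f c (suc m) ≡ neg (c ⊗ partialDot (λ i → f (suc i)) f c m)
    invS-suc f c m with (λ i → f (suc i))
    ... | g = ≡.refl

module PowerSeries {c ℓ} (S : CommutativeRing c ℓ) where
  open CommutativeRing S
  open Thm S using (constQ)
  open SeriesOps _+_ _*_ -_ 0# public
  open FormalInverse _+_ _*_ -_ 0#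
  open Algebra.Properties.Ring ring using (-‿distribʳ-*)
  open Algebra.Properties.CommutativeSemigroup +-commutativeSemigroup using (interchange)
  open Relation.Binary.Reasoning.Setoid setoid

  infix 4 _≋_
  -- As a record, the type keeps `f` and `g` visible as parameters; the bare pointwise statement
  -- would contain them only applied to an index.
  record _≋_ (f g : Series) : Set ℓ where
    constructor coeffwise
    field coeff : ∀ n → f n ≈ g n
  open _≋_ public

  shift : Series → Series
  shift f n = f (suc n)

  infixr 8 _·_
  _·_ : Carrier → Series → Series
  (r · f) n = r * f n

  0S : Series
  0S _ = 0#

  sumTo-cong : ∀ {f g} n → (∀ i → i ≤ n → f i ≈ g i) → sumTo f (suc n) ≈ sumTo g (suc n)
  sumTo-cong zero eq = +-congˡ (eq 0 z≤n)
  sumTo-cong (suc n) eq =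
    +-cong (sumTo-cong n (λ i i≤n → eq i (ℕₚ.m≤n⇒m≤1+n i≤n))) (eq (suc n) ℕₚ.≤-refl)

  sumTo-suc : ∀ f n → sumTo f (suc n) ≈ f 0 + sumTo (shift f) n
  sumTo-suc f zero = +-comm _ _
  sumTo-suc f (suc n) = trans (+-congʳ (sumTo-suc f n)) (+-assoc _ _ _)

  ⊠-zero : ∀ f g → (f ⊠ g) 0 ≈ f 0 * g 0
  ⊠-zero f g = +-identityˡ _

  ⊠-sucˡ : ∀ f g n → (f ⊠ g) (suc n) ≈ f 0 * g (suc n) + (shift f ⊠ g) n
  ⊠-sucˡ f g n = sumTo-suc _ (suc n)

  ⊠-sucʳ : ∀ f g n → (f ⊠ g) (suc n) ≈ (f ⊠ shift g) n + f (suc n) * g 0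
  ⊠-sucʳ f g n = +-cong
    (sumTo-cong n (λ i i≤n → *-congˡ (reflexive (≡.cong g (ℕₚ.+-∸-assoc 1 i≤n)))))
    (*-congˡ (reflexive (≡.cong g (ℕₚ.n∸n≡0 (suc n)))))

  ⊠-cong′ : ∀ {f f′ g g′} → f ≋ f′ → g ≋ g′ → ∀ n → (f ⊠ g) n ≈ (f′ ⊠ g′) n
  ⊠-cong′ p q n = sumTo-cong n (λ i _ → *-cong (coeff p i) (coeff q (n ∸ i)))

  ⊠-distribʳ : ∀ f g h n → ((g ⊞ h) ⊠ f) n ≈ (g ⊠ f) n + (h ⊠ f) n
  ⊠-distribʳ f g h zero = begin
    0# + (g 0 + h 0) * f 0 ≈⟨ +-identityˡ _ ⟩
    (g 0 + h 0) * f 0      ≈⟨ distribʳ _ _ _ ⟩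
    g 0 * f 0 + h 0 * f 0  ≈⟨ +-cong (⊠-zero g f) (⊠-zero h f) ⟨
    (g ⊠ f) 0 + (h ⊠ f) 0  ∎
  ⊠-distribʳ f g h (suc n) = begin
    ((g ⊞ h) ⊠ f) (suc n)
      ≈⟨ ⊠-sucˡ (g ⊞ h) f n ⟩
    (g 0 + h 0) * f (suc n) + ((shift g ⊞ shift h) ⊠ f) n
      ≈⟨ +-cong (distribʳ _ _ _) (⊠-distribʳ f (shift g) (shift h) n) ⟩
    (g 0 * f (suc n) + h 0 * f (suc n)) + ((shift g ⊠ f) n + (shift h ⊠ f) n)
      ≈⟨ interchange _ _ _ _ ⟩
    (g 0 * f (suc n) + (shift g ⊠ f) n) + (h 0 * f (suc n) + (shift h ⊠ f) n)
      ≈⟨ +-cong (⊠-sucˡ g f n) (⊠-sucˡ h f n) ⟨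
    (g ⊠ f) (suc n) + (h ⊠ f) (suc n) ∎

  ⊠-comm : ∀ f g n → (f ⊠ g) n ≈ (g ⊠ f) n
  ⊠-comm f g zero = +-congˡ (*-comm _ _)
  ⊠-comm f g (suc n) = begin
    (f ⊠ g) (suc n)                  ≈⟨ ⊠-sucˡ f g n ⟩
    f 0 * g (suc n) + (shift f ⊠ g) n ≈⟨ +-cong (*-comm _ _) (⊠-comm (shift f) g n) ⟩
    g (suc n) * f 0 + (g ⊠ shift f) n ≈⟨ +-comm _ _ ⟩
    (g ⊠ shift f) n + g (suc n) * f 0 ≈⟨ ⊠-sucʳ g f n ⟨
    (g ⊠ f) (suc n)                  ∎

  ·-⊠ : ∀ r f g n → ((r · f) ⊠ g) n ≈ r * (f ⊠ g) n
  ·-⊠ r f g zero = begin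
    0# + r * f 0 * g 0   ≈⟨ +-identityˡ _ ⟩
    r * f 0 * g 0        ≈⟨ *-assoc _ _ _ ⟩
    r * (f 0 * g 0)      ≈⟨ *-congˡ (⊠-zero f g) ⟨
    r * (f ⊠ g) 0        ∎
  ·-⊠ r f g (suc n) = begin
    ((r · f) ⊠ g) (suc n)
      ≈⟨ ⊠-sucˡ (r · f) g n ⟩
    r * f 0 * g (suc n) + ((r · shift f) ⊠ g) n
      ≈⟨ +-cong (*-assoc _ _ _) (·-⊠ r (shift f) g n) ⟩
    r * (f 0 * g (suc n)) + r * (shift f ⊠ g) n
      ≈⟨ distribˡ _ _ _ ⟨
    r * (f 0 * g (suc n) + (shift f ⊠ g) n)
      ≈⟨ *-congˡ (⊠-sucˡ f g n) ⟨
    r * (f ⊠ g) (suc n) ∎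

  ⊠-assoc : ∀ f g h n → ((f ⊠ g) ⊠ h) n ≈ (f ⊠ (g ⊠ h)) n
  ⊠-assoc f g h zero = begin
    0# + (f ⊠ g) 0 * h 0   ≈⟨ +-congˡ (*-congʳ (⊠-zero f g)) ⟩
    0# + f 0 * g 0 * h 0   ≈⟨ +-congˡ (*-assoc _ _ _) ⟩
    0# + f 0 * (g 0 * h 0) ≈⟨ +-congˡ (*-congˡ (⊠-zero g h)) ⟨
    0# + f 0 * (g ⊠ h) 0   ∎
  ⊠-assoc f g h (suc n) = begin
    ((f ⊠ g) ⊠ h) (suc n)
      ≈⟨ ⊠-sucˡ (f ⊠ g) h n ⟩
    (f ⊠ g) 0 * h (suc n) + (shift (f ⊠ g) ⊠ h) n
      ≈⟨ +-cong (*-congʳ (⊠-zero f g))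
                (⊠-cong′ {g = h} (coeffwise (⊠-sucˡ f g)) (coeffwise (λ _ → refl)) n) ⟩
    f 0 * g 0 * h (suc n) + (((f 0 · shift g) ⊞ (shift f ⊠ g)) ⊠ h) n
      ≈⟨ +-cong (*-assoc _ _ _) (⊠-distribʳ h (f 0 · shift g) (shift f ⊠ g) n) ⟩
    f 0 * (g 0 * h (suc n)) + (((f 0 · shift g) ⊠ h) n + ((shift f ⊠ g) ⊠ h) n)
      ≈⟨ +-congˡ (+-cong (·-⊠ (f 0) (shift g) h n) (⊠-assoc (shift f) g h n)) ⟩
    f 0 * (g 0 * h (suc n)) + (f 0 * (shift g ⊠ h) n + (shift f ⊠ (g ⊠ h)) n)
      ≈⟨ +-assoc _ _ _ ⟨
    (f 0 * (g 0 * h (suc n)) + f 0 * (shift g ⊠ h) n) + (shift f ⊠ (g ⊠ h)) n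
      ≈⟨ +-congʳ (distribˡ _ _ _) ⟨
    f 0 * (g 0 * h (suc n) + (shift g ⊠ h) n) + (shift f ⊠ (g ⊠ h)) n
      ≈⟨ +-congʳ (*-congˡ (⊠-sucˡ g h n)) ⟨
    f 0 * (g ⊠ h) (suc n) + (shift f ⊠ (g ⊠ h)) n
      ≈⟨ ⊠-sucˡ f (g ⊠ h) n ⟨
    (f ⊠ (g ⊠ h)) (suc n) ∎

  0S-⊠ : ∀ f n → (0S ⊠ f) n ≈ 0#
  0S-⊠ f zero = trans (⊠-zero 0S f) (zeroˡ _)
  0S-⊠ f (suc n) = begin
    (0S ⊠ f) (suc n)            ≈⟨ ⊠-sucˡ 0S f n ⟩
    0# * f (suc n) + (0S ⊠ f) n ≈⟨ +-cong (zeroˡ _) (0S-⊠ f n) ⟩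
    0# + 0#                     ≈⟨ +-identityˡ _ ⟩
    0#                          ∎

  const-⊠ : ∀ r f n → (constQ r ⊠ f) n ≈ r * f n
  const-⊠ r f zero = ⊠-zero (constQ r) f
  const-⊠ r f (suc n) = begin
    (constQ r ⊠ f) (suc n)       ≈⟨ ⊠-sucˡ (constQ r) f n ⟩
    r * f (suc n) + (0S ⊠ f) n   ≈⟨ +-congˡ (0S-⊠ f n) ⟩
    r * f (suc n) + 0#           ≈⟨ +-identityʳ _ ⟩
    r * f (suc n)                ∎

  constQ-* : ∀ r s → constQ r ⊠ constQ s ≋ constQ (r * s)
  constQ-* r s = coeffwise λ where
    zero → const-⊠ r (constQ s) 0
    (suc n) → trans (const-⊠ r (constQ s) (suc n)) (zeroʳ r)

  constQ-+ : ∀ r s → constQ r ⊞ constQ s ≋ constQ (r + s)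
  constQ-+ r s = coeffwise λ where
    zero → refl
    (suc n) → +-identityˡ 0#

  constQ-cong : ∀ {r s} → r ≈ s → constQ r ≋ constQ s
  constQ-cong p = coeffwise λ where
    zero → p
    (suc n) → refl

  ⊠-identityˡ : ∀ f n → (constQ 1# ⊠ f) n ≈ f n
  ⊠-identityˡ f n = trans (const-⊠ 1# f n) (*-identityˡ _)

  seriesRing : CommutativeRing c ℓ
  seriesRing = record
    { Carrier = Series
    ; _≈_ = _≋_
    ; _+_ = _⊞_
    ; _*_ = _⊠_
    ; -_ = ⊟_
    ; 0# = 0S
    ; 1# = constQ 1#
    ; isCommutativeRing = record
      { isRing = record
        { +-isAbelianGroup = record
          { isGroup = record
            { isMonoid = record
              { isSemigroup = record
                { isMagma = record
                  { isEquivalence = record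
                    { refl = coeffwise (λ _ → refl)
                    ; sym = λ p → coeffwise (λ n → sym (coeff p n))
                    ; trans = λ p q → coeffwise (λ n → trans (coeff p n) (coeff q n)) }
                  ; ∙-cong = λ p q → coeffwise (λ n → +-cong (coeff p n) (coeff q n)) }
                ; assoc = λ f g h → coeffwise (λ n → +-assoc (f n) (g n) (h n)) }
              ; identity = (λ f → coeffwise (λ n → +-identityˡ (f n)))
                         , (λ f → coeffwise (λ n → +-identityʳ (f n))) }
            ; inverse = (λ f → coeffwise (λ n → -‿inverseˡ (f n)))
                      , (λ f → coeffwise (λ n → -‿inverseʳ (f n)))
            ; ⁻¹-cong = λ p → coeffwise (λ n → -‿cong (coeff p n)) }
          ; comm = λ f g → coeffwise (λ n → +-comm (f n) (g n)) }
        ; *-cong = λ p q → coeffwise (⊠-cong′ p q)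
        ; *-assoc = λ f g h → coeffwise (⊠-assoc f g h)
        ; *-identity = (λ f → coeffwise (⊠-identityˡ f))
                     , (λ f → coeffwise (λ n → trans (⊠-comm f (constQ 1#) n) (⊠-identityˡ f n)))
        ; distrib = (λ f g h → coeffwise (λ n →
                       trans (⊠-comm f (g ⊞ h) n)
                      (trans (⊠-distribʳ f g h n)
                             (+-cong (⊠-comm g f n) (⊠-comm h f n)))))
                  , (λ f g h → coeffwise (⊠-distribʳ f g h)) }
      ; *-comm = λ f g → coeffwise (⊠-comm f g) } }

  -- The coefficients of the inverse are stored in reverse order, so pairing `g` with that list from
  -- the front is a Cauchy product.
  partialDot-⊠ : ∀ g f c m → partialDot g f c m ≈ (g ⊠ invS f c) m
  partialDot-⊠ g f c zero = +-comm _ _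
  partialDot-⊠ g f c (suc m) =
    trans (+-congˡ (partialDot-⊠ (shift g) f c m)) (sym (⊠-sucˡ g (invS f c) m))

  -- The recursion for the inverse makes each higher coefficient of the product equal to -(f₀c)d +
  -- d, where d is the convolution of the earlier coefficients with the tail of `f`.
  ⊠-invS : ∀ f c → f 0 * c ≈ 1# → f ⊠ invS f c ≋ constQ 1#
  ⊠-invS f c f₀c≈1 = coeffwise go
    where
    go : ∀ n → (f ⊠ invS f c) n ≈ constQ 1# n
    go zero = trans (⊠-zero f (invS f c)) f₀c≈1
    go (suc m) = begin
      (f ⊠ invS f c) (suc m)
        ≈⟨ ⊠-sucˡ f (invS f c) m ⟩
      f 0 * - (c * partialDot (shift f) f c m) + (shift f ⊠ invS f c) m
        ≈⟨ +-congˡ (partialDot-⊠ (shift f) f c m) ⟨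
      f 0 * - (c * d) + d
        ≈⟨ +-congʳ (-‿distribʳ-* (f 0) (c * d)) ⟨
      - (f 0 * (c * d)) + d
        ≈⟨ +-congʳ (-‿cong (*-assoc (f 0) c d)) ⟨
      - (f 0 * c * d) + d
        ≈⟨ +-congʳ (-‿cong (*-congʳ f₀c≈1)) ⟩
      - (1# * d) + d
        ≈⟨ +-congʳ (-‿cong (*-identityˡ d)) ⟩
      - d + d
        ≈⟨ -‿inverseˡ d ⟩
      0# ∎
      where d = partialDot (shift f) f c m

module Powers {c ℓ} (S : CommutativeRing c ℓ) where
  open CommutativeRing S
  open Thm S using (pow)
  open Algebra.Properties.CommutativeSemigroup *-commutativeSemigroup using (interchange)

  pow-cong : ∀ {a b} n → a ≈ b → pow a n ≈ pow b n
  pow-cong zero p = refl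
  pow-cong (suc n) p = *-cong p (pow-cong n p)

  pow-+ : ∀ a m n → pow a (m ℕ.+ n) ≈ pow a m * pow a n
  pow-+ a zero n = sym (*-identityˡ _)
  pow-+ a (suc m) n = trans (*-congˡ (pow-+ a m n)) (sym (*-assoc _ _ _))

  pow-* : ∀ a b n → pow (a * b) n ≈ pow a n * pow b n
  pow-* a b zero = sym (*-identityˡ _)
  pow-* a b (suc n) = trans (*-congˡ (pow-* a b n)) (interchange _ _ _ _)

  pow-1# : ∀ n → pow 1# n ≈ 1#
  pow-1# zero = refl
  pow-1# (suc n) = trans (*-identityˡ _) (pow-1# n)

-- The substitution u ↦ tu: `scale t f` is f(tu).

module Rescaling {c ℓ} (S : CommutativeRing c ℓ) where
  open CommutativeRing S
  open Thm S using (pow; constQ)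
  open Powers S
  open PowerSeries S
  private module B = CommutativeRing seriesRing
  open Algebra.Properties.CommutativeSemigroup *-commutativeSemigroup using (x∙yz≈y∙xz)
  open Relation.Binary.Reasoning.Setoid setoid

  scale : Carrier → Series → Series
  scale t f n = pow t n * f n

  var : Series
  var 0 = 0#
  var 1 = 1#
  var (suc (suc _)) = 0#

  scale-cong : ∀ {s t f g} → s ≈ t → f ≋ g → scale s f ≋ scale t g
  scale-cong p q = coeffwise (λ n → *-cong (pow-cong n p) (coeff q n))

  scale-⊞ : ∀ t f g → scale t (f ⊞ g) ≋ scale t f ⊞ scale t g
  scale-⊞ t f g = coeffwise (λ n → distribˡ _ _ _)

  scale-scale : ∀ s t f → scale s (scale t f) ≋ scale (s * t) f
  scale-scale s t f = coeffwise (λ n →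
    trans (sym (*-assoc _ _ _)) (*-congʳ (sym (pow-* s t n))))

  scale-comm : ∀ s t f → scale s (scale t f) ≋ scale t (scale s f)
  scale-comm s t f = B.trans (scale-scale s t f)
    (B.trans (scale-cong (*-comm s t) B.refl) (B.sym (scale-scale t s f)))

  scale-1# : ∀ f → scale 1# f ≋ f
  scale-1# f = coeffwise (λ n → trans (*-congʳ (pow-1# n)) (*-identityˡ _))

  scale-const : ∀ t r → scale t (constQ r) ≋ constQ r
  scale-const t r = coeffwise λ where
    zero → *-identityˡ r
    (suc n) → zeroʳ _

  scale-var : ∀ t → scale t var ≋ constQ t ⊠ var
  scale-var t = coeffwise λ where
    zero → trans (zeroʳ _) (sym (trans (const-⊠ t var 0) (zeroʳ t)))
    (suc zero) → trans (*-congʳ (*-identityʳ t)) (sym (const-⊠ t var 1))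
    (suc (suc n)) → trans (zeroʳ _) (sym (trans (const-⊠ t var (suc (suc n))) (zeroʳ t)))

  -- Induction on the coefficient, with `f` replaced by its tail: the tail of f(tu) is t times the
  -- tail of f taken at tu.
  scale-⊠ : ∀ t f g → scale t (f ⊠ g) ≋ scale t f ⊠ scale t g
  scale-⊠ t f g = coeffwise (go f)
    where
    shift-scale : ∀ f → shift (scale t f) ≋ t · scale t (shift f)
    shift-scale f = coeffwise (λ n → *-assoc _ _ _)

    go : ∀ f n → scale t (f ⊠ g) n ≈ (scale t f ⊠ scale t g) n
    go f zero = begin
      1# * (f ⊠ g) 0              ≈⟨ *-identityˡ _ ⟩
      (f ⊠ g) 0                   ≈⟨ ⊠-zero f g ⟩
      f 0 * g 0                   ≈⟨ *-cong (*-identityˡ _) (*-identityˡ _) ⟨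
      scale t f 0 * scale t g 0   ≈⟨ ⊠-zero (scale t f) (scale t g) ⟨
      (scale t f ⊠ scale t g) 0   ∎
    go f (suc n) = begin
      pow t (suc n) * (f ⊠ g) (suc n)
        ≈⟨ *-congˡ (⊠-sucˡ f g n) ⟩
      pow t (suc n) * (f 0 * g (suc n) + (shift f ⊠ g) n)
        ≈⟨ distribˡ _ _ _ ⟩
      pow t (suc n) * (f 0 * g (suc n)) + t * pow t n * (shift f ⊠ g) n
        ≈⟨ +-cong (x∙yz≈y∙xz _ _ _) (*-assoc _ _ _) ⟩
      f 0 * scale t g (suc n) + t * scale t (shift f ⊠ g) n
        ≈⟨ +-cong (*-congʳ (sym (*-identityˡ _))) (*-congˡ (go (shift f) n)) ⟩
      scale t f 0 * scale t g (suc n) + t * (scale t (shift f) ⊠ scale t g) n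
        ≈⟨ +-congˡ (·-⊠ t (scale t (shift f)) (scale t g) n) ⟨
      scale t f 0 * scale t g (suc n) + ((t · scale t (shift f)) ⊠ scale t g) n
        ≈⟨ +-congˡ (coeff (B.*-congʳ {x = scale t g} (shift-scale f)) n) ⟨
      scale t f 0 * scale t g (suc n) + (shift (scale t f) ⊠ scale t g) n
        ≈⟨ ⊠-sucˡ (scale t f) (scale t g) n ⟨
      (scale t f ⊠ scale t g) (suc n) ∎

  var-⊠-zero : ∀ f → (var ⊠ f) 0 ≈ 0#
  var-⊠-zero f = trans (⊠-zero var f) (zeroˡ _)

  var-⊠-suc : ∀ f n → (var ⊠ f) (suc n) ≈ f n
  var-⊠-suc f n = begin
    (var ⊠ f) (suc n)                   ≈⟨ ⊠-sucˡ var f n ⟩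
    0# * f (suc n) + (shift var ⊠ f) n  ≈⟨ +-cong (zeroˡ _) (⊠-cong′ shift-var (B.refl {f}) n) ⟩
    0# + (constQ 1# ⊠ f) n              ≈⟨ +-identityˡ _ ⟩
    (constQ 1# ⊠ f) n                   ≈⟨ ⊠-identityˡ f n ⟩
    f n                                 ∎
    where
    shift-var : shift var ≋ constQ 1#
    shift-var = coeffwise λ where
      zero → refl
      (suc n) → refl

-- Linear q-difference equations and their uniqueness.

module qDifference {c ℓ} (S : CommutativeRing c ℓ) (q : CommutativeRing.Carrier S) where
  open CommutativeRing S
  open Thm S using (pow; constQ)
  open PowerSeries S
  open Rescaling S
  private module B = CommutativeRing seriesRing

  η : Series → Series
  η = scale q

  -- f satisfies (f(u) - f(qu)) / u = g(u).
  infix 4 _hasDifference_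
  _hasDifference_ : Series → Series → Set ℓ
  f hasDifference g = f ≋ η f ⊞ (var ⊠ g)

  fromCoeffs : ∀ {f g} → (∀ n → f (suc n) ≈ pow q (suc n) * f (suc n) + g n) →
    f hasDifference g
  fromCoeffs {f} {g} p = coeffwise λ where
    zero → sym (trans (+-cong (*-identityˡ _) (var-⊠-zero g)) (+-identityʳ _))
    (suc n) → trans (p n) (+-congˡ (sym (var-⊠-suc g n)))

  toCoeffs : ∀ {f g} → f hasDifference g →
    ∀ n → f (suc n) ≈ pow q (suc n) * f (suc n) + g n
  toCoeffs {f} {g} p n = trans (coeff p (suc n)) (+-congˡ (var-⊠-suc g n))

  hasDifference-resp : ∀ {f g h} → g ≋ h → f hasDifference g → f hasDifference h
  hasDifference-resp p d = B.trans d (B.+-congˡ (B.*-congˡ p))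

  module Uniqueness
    (cancel : ∀ n {a b r} → a ≈ pow q (suc n) * a + r → b ≈ pow q (suc n) * b + r → a ≈ b)
    where

    -- The coefficient of index i in `h ⊠ f` involves only f₀, ..., fᵢ, so the equation has the form
    -- fᵢ₊₁ = qⁱ⁺¹ fᵢ₊₁ + r with r already known. `cancel` is exactly the uniqueness of the solution
    -- of such an equation, a subtraction-free form of the cancellability of 1-qⁱ⁺¹.
    linear-unique : ∀ {f g h} → f hasDifference (h ⊠ f) → g hasDifference (h ⊠ g) →
      f 0 ≈ g 0 → f ≋ g
    linear-unique {f} {g} {h} p r f₀≈g₀ = coeffwise (λ n → upTo n n ℕₚ.≤-refl)
      where
      -- The bound `n` makes course-of-values induction structural: index i+1 needs the equality at
      -- every index up to i.
      upTo : ∀ n i → i ≤ n → f i ≈ g i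
      upTo n zero _ = f₀≈g₀
      upTo (suc n) (suc i) (s≤s i≤n) = cancel i
        (toCoeffs {g = h ⊠ f} p i)
        (trans (toCoeffs {g = h ⊠ g} r i) (+-congˡ (sumTo-cong i (λ j j≤i →
          *-congˡ {h j} (sym (upTo n (i ∸ j) (ℕₚ.≤-trans (ℕₚ.m∸n≤m i j) i≤n)))))))

-- Functional equations in an arbitrary commutative ring

-- A prime stands for the substitution u ↦ uq.
module CommutativeRingIdentities {c ℓ} (B : CommutativeRing c ℓ) where
  open CommutativeRing B
  open Algebra.Properties.Group +-group using () renaming (∙-cancelʳ to +-cancelʳ)
  open Algebra.Solver.Ring.NaturalCoefficients.Default commutativeSemiring
  open Relation.Binary.Reasoning.Setoid setoid

  -- The equation for C gives C + p = (C′ + p)(1 + uC). Hence E(C + p) = (C′ + p)(E + uEC), and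
  -- replacing the first E by E′ + puE supplies the missing p in u(C′ + p)E(C + p).
  exponential-difference : ∀ {y p u C C′ E E′} →
    C ≈ C′ + u * ((C′ + p) * C) → E ≈ E′ + p * u * E →
    y * (E * (C + p)) ≈ y * (E′ * (C′ + p)) + u * ((C′ + p) * (y * (E * (C + p))))
  exponential-difference {y} {p} {u} {C} {C′} {E} {E′} C-eq E-eq = begin
    y * (E * (C + p))
      ≈⟨ *-congˡ (*-congˡ (+-congʳ C-eq)) ⟩
    y * (E * (C′ + u * ((C′ + p) * C) + p))
      ≈⟨ solve 6 (λ y p u C C′ E →
           y :* (E :* (C′ :+ u :* ((C′ :+ p) :* C) :+ p)) :=
           y :* (C′ :+ p) :* E :+ u :* ((C′ :+ p) :* (y :* (E :* C))))
           refl y p u C C′ E ⟩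
    y * (C′ + p) * E + u * ((C′ + p) * (y * (E * C)))
      ≈⟨ +-congʳ (*-congˡ E-eq) ⟩
    y * (C′ + p) * (E′ + p * u * E) + u * ((C′ + p) * (y * (E * C)))
      ≈⟨ solve 7 (λ y p u C C′ E E′ →
           y :* (C′ :+ p) :* (E′ :+ p :* u :* E) :+ u :* ((C′ :+ p) :* (y :* (E :* C))) :=
           y :* (E′ :* (C′ :+ p)) :+ u :* ((C′ :+ p) :* (y :* (E :* (C :+ p)))))
           refl y p u C C′ E E′ ⟩
    y * (E′ * (C′ + p)) + u * ((C′ + p) * (y * (E * (C + p)))) ∎

  linear-difference : ∀ x C′ u a C → x * (C′ + u * (a * C)) ≈ x * C′ + u * (a * (x * C))
  linear-difference = solve 5 (λ x C′ u a C →
    x :* (C′ :+ u :* (a :* C)) := x :* C′ :+ u :* (a :* (x :* C))) refl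

  -- Here k = y/x, s = z-y, t = x-z, N = 1 - kE′ and D = 1 - βsu - k(1 + βtu)E′. Multiplying the
  -- equation for G by N leaves C′ only in N(C′ + s), which the closed form of C′ turns into s +
  -- ktE′; and N - uβ(s + ktE′) is D. The hypotheses and steps add terms to both sides instead of
  -- subtracting, so that each rearrangement is a semiring identity.
  functional-equation : ∀ {k s t p β u C′ E′ G G′ N D} →
    s + t ≈ p → C′ ≈ k * (E′ * (C′ + p)) →
    G ≈ G′ + u * (β * ((C′ + s) * G)) →
    N + k * E′ ≈ 1# →
    D + (β * s * u + k * (1# + β * t * u) * E′) ≈ 1# →
    D * G ≈ N * G′
  functional-equation {k} {s} {t} {p} {β} {u} {C′} {E′} {G} {G′} {N} {D}
    s+t≈p C-eq G-eq N-eq D-eq = +-cancelʳ (u * β * (N * (C′ + s)) * G) _ _ (begin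
      D * G + u * β * (N * (C′ + s)) * G
        ≈⟨ +-congˡ (*-congʳ (*-congˡ numerator-factor)) ⟩
      D * G + u * β * (s + k * t * E′) * G
        ≈⟨ distribʳ G D _ ⟨
      (D + u * β * (s + k * t * E′)) * G
        ≈⟨ *-congʳ N-D ⟨
      N * G
        ≈⟨ *-congˡ G-eq ⟩
      N * (G′ + u * (β * ((C′ + s) * G)))
        ≈⟨ solve 7 (λ N G G′ u β C′ s →
             N :* (G′ :+ u :* (β :* ((C′ :+ s) :* G))) :=
             N :* G′ :+ u :* β :* (N :* (C′ :+ s)) :* G)
             refl N G G′ u β C′ s ⟩
      N * G′ + u * β * (N * (C′ + s)) * G ∎)
    where
    -- The closed form says (1 - kE′)C′ = kpE′, and kpE′ - ksE′ = ktE′ because p = s + t.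
    numerator-factor : N * (C′ + s) ≈ s + k * t * E′
    numerator-factor = +-cancelʳ (k * E′ * (C′ + s)) _ _ (begin
      N * (C′ + s) + k * E′ * (C′ + s)    ≈⟨ distribʳ _ _ _ ⟨
      (N + k * E′) * (C′ + s)             ≈⟨ *-congʳ N-eq ⟩
      1# * (C′ + s)                       ≈⟨ *-identityˡ _ ⟩
      C′ + s                              ≈⟨ +-congʳ C-eq ⟩
      k * (E′ * (C′ + p)) + s             ≈⟨ +-congʳ (*-congˡ (*-congˡ (+-congˡ s+t≈p))) ⟨
      k * (E′ * (C′ + (s + t))) + s
        ≈⟨ solve 5 (λ k E′ C′ s t →
             k :* (E′ :* (C′ :+ (s :+ t))) :+ s :=
             s :+ k :* t :* E′ :+ k :* E′ :* (C′ :+ s))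
             refl k E′ C′ s t ⟩
      s + k * t * E′ + k * E′ * (C′ + s)  ∎)

    N-D : N ≈ D + u * β * (s + k * t * E′)
    N-D = +-cancelʳ (k * E′) _ _ (begin
      N + k * E′ ≈⟨ N-eq ⟩
      1#         ≈⟨ D-eq ⟨
      D + (β * s * u + k * (1# + β * t * u) * E′)
        ≈⟨ solve 7 (λ D β s u k t E′ →
             D :+ (β :* s :* u :+ k :* (con 1 :+ β :* t :* u) :* E′) :=
             D :+ u :* β :* (s :+ k :* t :* E′) :+ k :* E′)
             refl D β s u k t E′ ⟩
      D + u * β * (s + k * t * E′) + k * E′ ∎)

-- Closed form of the Eulerian series C.

module EulerianSolution {c ℓ} (S : CommutativeRing c ℓ) (q : CommutativeRing.Carrier S) where
  open CommutativeRing S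
  open Thm S using (pow; constQ)
  open PowerSeries S
  open Rescaling S
  open qDifference S q
  private module B = CommutativeRing seriesRing
  open CommutativeRingIdentities seriesRing

  scale-difference : ∀ {e} p → e hasDifference e →
    scale p e ≋ η (scale p e) ⊞ (constQ p ⊠ var) ⊠ scale p e
  scale-difference {e} p e-diff = begin
    scale p e                                     ≈⟨ scale-cong refl e-diff ⟩
    scale p (η e ⊞ (var ⊠ e))                     ≈⟨ scale-⊞ p (η e) (var ⊠ e) ⟩
    scale p (η e) ⊞ scale p (var ⊠ e)             ≈⟨ B.+-cong (scale-comm p q e) (scale-⊠ p var e) ⟩
    η (scale p e) ⊞ scale p var ⊠ scale p e       ≈⟨ B.+-congˡ {η (scale p e)} (B.*-congʳ {scale p e} (scale-var p)) ⟩
    η (scale p e) ⊞ (constQ p ⊠ var) ⊠ scale p e  ∎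
    where open Relation.Binary.Reasoning.Setoid B.setoid

  module _
    (cancel : ∀ n {a b r} → a ≈ pow q (suc n) * a + r → b ≈ pow q (suc n) * b + r → a ≈ b)
    where
    open Uniqueness cancel

    -- Both sides solve f(u) - f(qu) = u (C(qu) + p) f(u).
    eulerian : ∀ {x y p e C} → y + p ≈ x → e 0 ≈ 1# → e hasDifference e →
      C 0 ≈ y → C hasDifference ((η C ⊞ constQ p) ⊠ C) →
      constQ x ⊠ C ≋ constQ y ⊠ (scale p e ⊠ (C ⊞ constQ p))
    eulerian {x} {y} {p} {e} {C} y+p≈x e₀≈1 e-diff C₀≈y C-diff =
      linear-unique {h = A} left right initial
      where
      A = η C ⊞ constQ p
      E = scale p e

      left : constQ x ⊠ C hasDifference (A ⊠ (constQ x ⊠ C))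
      left = begin
        constQ x ⊠ C
          ≈⟨ B.*-congˡ {constQ x} C-diff ⟩
        constQ x ⊠ (η C ⊞ (var ⊠ (A ⊠ C)))
          ≈⟨ linear-difference (constQ x) (η C) var A C ⟩
        constQ x ⊠ η C ⊞ (var ⊠ (A ⊠ (constQ x ⊠ C)))
          ≈⟨ B.+-congʳ {var ⊠ (A ⊠ (constQ x ⊠ C))} (B.trans (scale-⊠ q (constQ x) C) (B.*-congʳ {η C} (scale-const q x))) ⟨
        η (constQ x ⊠ C) ⊞ (var ⊠ (A ⊠ (constQ x ⊠ C))) ∎
        where open Relation.Binary.Reasoning.Setoid B.setoid

      right : constQ y ⊠ (E ⊠ (C ⊞ constQ p)) hasDifference
              (A ⊠ (constQ y ⊠ (E ⊠ (C ⊞ constQ p))))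
      right = B.trans
        (exponential-difference C-diff (scale-difference p e-diff))
        (B.+-congʳ {var ⊠ (A ⊠ (constQ y ⊠ (E ⊠ (C ⊞ constQ p))))} (B.sym (begin
          η (constQ y ⊠ (E ⊠ (C ⊞ constQ p)))
            ≈⟨ scale-⊠ q (constQ y) (E ⊠ (C ⊞ constQ p)) ⟩
          η (constQ y) ⊠ η (E ⊠ (C ⊞ constQ p))
            ≈⟨ B.*-cong (scale-const q y) (scale-⊠ q E (C ⊞ constQ p)) ⟩
          constQ y ⊠ (η E ⊠ η (C ⊞ constQ p))
            ≈⟨ B.*-congˡ {constQ y} (B.*-congˡ {η E} (B.trans (scale-⊞ q C (constQ p)) (B.+-congˡ {η C} (scale-const q p)))) ⟩
          constQ y ⊠ (η E ⊠ (η C ⊞ constQ p)) ∎)))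
        where open Relation.Binary.Reasoning.Setoid B.setoid

      -- At u = 0 both sides are xy, because C has constant term y and y + p = x.
      initial : (constQ x ⊠ C) 0 ≈ (constQ y ⊠ (E ⊠ (C ⊞ constQ p))) 0
      initial = begin
        (constQ x ⊠ C) 0         ≈⟨ const-⊠ x C 0 ⟩
        x * C 0                  ≈⟨ *-cong (sym y+p≈x) C₀≈y ⟩
        (y + p) * y              ≈⟨ *-comm _ _ ⟩
        y * (y + p)              ≈⟨ *-congˡ (+-congʳ (sym C₀≈y)) ⟩
        y * (C 0 + p)            ≈⟨ *-congˡ (sym (trans (*-congʳ (trans (*-identityˡ _) e₀≈1)) (*-identityˡ _))) ⟩
        y * (E 0 * (C 0 + p))    ≈⟨ *-congˡ (sym (⊠-zero E (C ⊞ constQ p))) ⟩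
        y * (E ⊠ (C ⊞ constQ p)) 0 ≈⟨ sym (const-⊠ y (E ⊠ (C ⊞ constQ p)) 0) ⟩
        (constQ y ⊠ (E ⊠ (C ⊞ constQ p))) 0 ∎
        where
        open Relation.Binary.Reasoning.Setoid setoid

-- Words and their statistics

module Words where
  open import Data.Nat using (_+_)
  open import Relation.Binary.PropositionalEquality

  <ᵇ-true : ∀ {m n} → m < n → (m <ᵇ n) ≡ true
  <ᵇ-true {zero} {suc n} _ = refl
  <ᵇ-true {suc m} {suc n} (s≤s m<n) = <ᵇ-true m<n

  <ᵇ-false : ∀ {m n} → n ≤ m → (m <ᵇ n) ≡ false
  <ᵇ-false {zero} {zero} _ = refl
  <ᵇ-false {suc m} {zero} _ = refl
  <ᵇ-false {suc m} {suc n} (s≤s n≤m) = <ᵇ-false n≤m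

  concatMap-All : ∀ {a p} {A B : Set a} (f : A → List B) {P : A → Set p} {Q : B → Set p} →
    (∀ {x} → P x → All Q (f x)) → ∀ {xs} → All P xs → All Q (concatMap f xs)
  concatMap-All f h pxs = Allₚ.concat⁺ (Allₚ.map⁺ (All.map h pxs))

  AllPairs-resp-⊆ : ∀ {a r} {A : Set a} {R : A → A → Set r} {xs ys} → xs ⊆ ys → AllPairs R ys → AllPairs R xs
  AllPairs-resp-⊆ [] [] = []
  AllPairs-resp-⊆ (skip _ s) (_ ∷ r) = AllPairs-resp-⊆ s r
  AllPairs-resp-⊆ (refl ∷ s) (x ∷ r) = All-resp-⊆ s x ∷ AllPairs-resp-⊆ s r

  AllPairs-∷ʳ⁻ : ∀ {a r} {A : Set a} {R : A → A → Set r} xs {x} → AllPairs R (xs ∷ʳ x) →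
    AllPairs R xs × All (λ y → R y x) xs
  AllPairs-∷ʳ⁻ [] _ = [] , []
  AllPairs-∷ʳ⁻ (_ ∷ xs) (h ∷ r) =
    let hs , hx = Allₚ.∷ʳ⁻ h ; r′ , hs′ = AllPairs-∷ʳ⁻ xs r in hs ∷ r′ , hx ∷ hs′

  insertEverywhere-All : ∀ {p} {P : ℕ → Set p} {a} → P a → ∀ {τ} → All P τ →
    All (All P) (insertEverywhere a τ)
  insertEverywhere-All pa [] = (pa ∷ []) ∷ []
  insertEverywhere-All pa (pb ∷ pτ) =
    (pa ∷ pb ∷ pτ) ∷ Allₚ.map⁺ (All.map (pb ∷_) (insertEverywhere-All pa pτ))

  insertEverywhere-length : ∀ a τ → All (λ σ → length σ ≡ suc (length τ)) (insertEverywhere a τ)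
  insertEverywhere-length a [] = refl ∷ []
  insertEverywhere-length a (b ∷ τ) =
    refl ∷ Allₚ.map⁺ (All.map (cong suc) (insertEverywhere-length a τ))

  -- Arbitrary labels are allowed because the two sides of a cut carry subsets of the labels. On a
  -- decreasing list the head, the largest label, is inserted last, as in `perms`.
  permutationsOf : List ℕ → List (List ℕ)
  permutationsOf [] = [] ∷ []
  permutationsOf (a ∷ L) = concatMap (insertEverywhere a) (permutationsOf L)

  descending : ℕ → List ℕ
  descending = applyDownFrom suc

  perms≡permutationsOf : ∀ n → perms n ≡ permutationsOf (descending n)
  perms≡permutationsOf zero = refl
  perms≡permutationsOf (suc n) = cong (concatMap (insertEverywhere (suc n))) (perms≡permutationsOf n)

  permutationsOf-length : ∀ L → All (λ σ → length σ ≡ length L) (permutationsOf L)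
  permutationsOf-length [] = refl ∷ []
  permutationsOf-length (a ∷ L) = concatMap-All (insertEverywhere a)
    (λ {σ} eq → All.map (λ eq′ → trans eq′ (cong suc eq)) (insertEverywhere-length a σ))
    (permutationsOf-length L)

  insertInto : ℕ → List ℕ × List ℕ → List (List ℕ × List ℕ)
  insertInto a (τ , ρ) = map (_, ρ) (insertEverywhere a τ) ++ map (τ ,_) (insertEverywhere a ρ)

  -- All ways of distributing L over two words, in any order.
  splits : List ℕ → List (List ℕ × List ℕ)
  splits [] = ([] , []) ∷ []
  splits (a ∷ L) = concatMap (insertInto a) (splits L)

  splits-All : ∀ {p} {P : ℕ → Set p} {L} → All P L →
    All (λ (τ , ρ) → All P τ × All P ρ) (splits L)
  splits-All [] = ([] , []) ∷ []
  splits-All {L = a ∷ L} (pa ∷ pL) = concatMap-All (insertInto a)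
    (λ (pτ , pρ) → Allₚ.++⁺
      (Allₚ.map⁺ (All.map (_, pρ) (insertEverywhere-All pa pτ)))
      (Allₚ.map⁺ (All.map (pτ ,_) (insertEverywhere-All pa pρ))))
    (splits-All pL)

  join : ℕ → List ℕ × List ℕ → List ℕ
  join m (τ , ρ) = τ ++ m ∷ ρ

  insertEverywhere-++ : ∀ a m τ ρ → insertEverywhere a (τ ++ m ∷ ρ) ≡
    map (_++ m ∷ ρ) (insertEverywhere a τ) ++ map (λ ρ′ → τ ++ m ∷ ρ′) (insertEverywhere a ρ)
  insertEverywhere-++ a m [] ρ = refl
  insertEverywhere-++ a m (b ∷ τ) ρ = cong ((a ∷ b ∷ τ ++ m ∷ ρ) ∷_) (begin
    map (b ∷_) (insertEverywhere a (τ ++ m ∷ ρ))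
      ≡⟨ cong (map (b ∷_)) (insertEverywhere-++ a m τ ρ) ⟩
    map (b ∷_) (map (_++ m ∷ ρ) (insertEverywhere a τ) ++ map (λ ρ′ → τ ++ m ∷ ρ′) (insertEverywhere a ρ))
      ≡⟨ map-++ (b ∷_) (map (_++ m ∷ ρ) (insertEverywhere a τ)) _ ⟩
    map (b ∷_) (map (_++ m ∷ ρ) (insertEverywhere a τ)) ++ map (b ∷_) (map (λ ρ′ → τ ++ m ∷ ρ′) (insertEverywhere a ρ))
      ≡⟨ cong₂ _++_ (trans (sym (map-∘ (insertEverywhere a τ))) (map-∘ (insertEverywhere a τ)))
                    (sym (map-∘ (insertEverywhere a ρ))) ⟩
    map (_++ m ∷ ρ) (map (b ∷_) (insertEverywhere a τ)) ++ map (λ ρ′ → b ∷ τ ++ m ∷ ρ′) (insertEverywhere a ρ) ∎)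
    where open ≡-Reasoning

  insertEverywhere-join : ∀ a m τρ →
    insertEverywhere a (join m τρ) ≡ map (join m) (insertInto a τρ)
  insertEverywhere-join a m (τ , ρ) = begin
    insertEverywhere a (τ ++ m ∷ ρ)
      ≡⟨ insertEverywhere-++ a m τ ρ ⟩
    map (_++ m ∷ ρ) (insertEverywhere a τ) ++ map (λ ρ′ → τ ++ m ∷ ρ′) (insertEverywhere a ρ)
      ≡⟨ cong₂ _++_ (map-∘ (insertEverywhere a τ)) (map-∘ (insertEverywhere a ρ)) ⟩
    map (join m) (map (_, ρ) (insertEverywhere a τ)) ++ map (join m) (map (τ ,_) (insertEverywhere a ρ))
      ≡⟨ map-++ (join m) (map (_, ρ) (insertEverywhere a τ)) _ ⟨
    map (join m) (insertInto a (τ , ρ)) ∎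
    where open ≡-Reasoning

  -- The last label of the list is the first one inserted, so each other label later lands to its
  -- left or to its right. `splits` follows the same order of insertions, which gives an equality of
  -- lists and not only of multisets.
  permutationsOf-∷ʳ : ∀ L m → permutationsOf (L ∷ʳ m) ≡ map (join m) (splits L)
  permutationsOf-∷ʳ [] m = refl
  permutationsOf-∷ʳ (a ∷ L) m = begin
    concatMap (insertEverywhere a) (permutationsOf (L ∷ʳ m))
      ≡⟨ cong (concatMap (insertEverywhere a)) (permutationsOf-∷ʳ L m) ⟩
    concatMap (insertEverywhere a) (map (join m) (splits L))
      ≡⟨ concatMap-map (insertEverywhere a) (join m) (splits L) ⟩
    concatMap (insertEverywhere a ∘ join m) (splits L)
      ≡⟨ concatMap-cong (insertEverywhere-join a m) (splits L) ⟩
    concatMap (map (join m) ∘ insertInto a) (splits L)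
      ≡⟨ map-concatMap (join m) (insertInto a) (splits L) ⟨
    map (join m) (concatMap (insertInto a) (splits L)) ∎
    where open ≡-Reasoning

  smaller : ℕ → List ℕ → ℕ
  smaller t ρ = count (map (_<ᵇ t) ρ)

  crossInv : List ℕ → List ℕ → ℕ
  crossInv [] ρ = 0
  crossInv (t ∷ τ) ρ = smaller t ρ + crossInv τ ρ

  smaller-++ : ∀ t σ ρ → smaller t (σ ++ ρ) ≡ smaller t σ + smaller t ρ
  smaller-++ t [] ρ = refl
  smaller-++ t (s ∷ σ) ρ with s <ᵇ t
  ... | true = cong suc (smaller-++ t σ ρ)
  ... | false = smaller-++ t σ ρ

  smaller-all : ∀ {a ρ} → All (_< a) ρ → smaller a ρ ≡ length ρ
  smaller-all [] = refl
  smaller-all (r<a ∷ h) rewrite <ᵇ-true r<a = cong suc (smaller-all h)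

  smaller-none : ∀ {m ρ} → All (m <_) ρ → smaller m ρ ≡ 0
  smaller-none [] = refl
  smaller-none (m<r ∷ h) rewrite <ᵇ-false (ℕₚ.<⇒≤ m<r) = smaller-none h

  smaller-∷-< : ∀ {m t} → m < t → ∀ ρ → smaller t (m ∷ ρ) ≡ suc (smaller t ρ)
  smaller-∷-< m<t ρ rewrite <ᵇ-true m<t = refl

  smaller-∷-> : ∀ {a t} → t < a → ∀ ρ → smaller t (a ∷ ρ) ≡ smaller t ρ
  smaller-∷-> t<a ρ rewrite <ᵇ-false (ℕₚ.<⇒≤ t<a) = refl

  smaller-insert : ∀ {a t} → t < a → ∀ ρ →
    All (λ ρ′ → smaller t ρ′ ≡ smaller t ρ) (insertEverywhere a ρ)
  smaller-insert t<a [] = smaller-∷-> t<a [] ∷ []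
  smaller-insert {a} {t} t<a (b ∷ ρ) =
    smaller-∷-> t<a (b ∷ ρ) ∷ Allₚ.map⁺ (All.map (λ {ρ′} → rest ρ′) (smaller-insert t<a ρ))
    where
    rest : ∀ ρ′ → smaller t ρ′ ≡ smaller t ρ → smaller t (b ∷ ρ′) ≡ smaller t (b ∷ ρ)
    rest ρ′ eq with b <ᵇ t
    ... | true = cong suc eq
    ... | false = eq

  crossInv-insertʳ : ∀ {a τ} → All (_< a) τ → ∀ ρ →
    All (λ ρ′ → crossInv τ ρ′ ≡ crossInv τ ρ) (insertEverywhere a ρ)
  crossInv-insertʳ [] ρ = All.universal (λ _ → refl) _
  crossInv-insertʳ (t<a ∷ h) ρ =
    All.zipWith (λ (e , e′) → cong₂ _+_ e e′) (smaller-insert t<a ρ , crossInv-insertʳ h ρ)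

  -- A letter above all of ρ and standing to its left is inverted with every letter of ρ. This is
  -- the source of the power of q in the q-Pascal rule; on the right of τ such a letter creates no
  -- cross inversion.
  crossInv-insertˡ : ∀ {a ρ} → All (_< a) ρ → ∀ τ →
    All (λ τ′ → crossInv τ′ ρ ≡ length ρ + crossInv τ ρ) (insertEverywhere a τ)
  crossInv-insertˡ h [] = cong (_+ 0) (smaller-all h) ∷ []
  crossInv-insertˡ {a} {ρ} h (b ∷ τ) =
    cong (_+ crossInv (b ∷ τ) ρ) (smaller-all h) ∷
    Allₚ.map⁺ (All.map (λ e → trans (cong (smaller b ρ +_) e) (swap (smaller b ρ) (length ρ) _))
                       (crossInv-insertˡ h τ))
    where
    swap : ∀ i j k → i + (j + k) ≡ j + (i + k)
    swap i j k = trans (sym (ℕₚ.+-assoc i j k)) (trans (cong (_+ k) (ℕₚ.+-comm i j)) (ℕₚ.+-assoc j i k))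

  -- Statistics of a word cut at its smallest letter m.

  module _ {m : ℕ} where

    -- The letter `m` is inverted with each letter of τ and with none of ρ. Its share `length τ` is
    -- grouped with `inv τ` because the two form the weight of the prefix.
    inv-join : ∀ {τ ρ} → All (m <_) τ → All (m <_) ρ →
      inv (τ ++ m ∷ ρ) ≡ crossInv τ ρ + ((length τ + inv τ) + inv ρ)
    inv-join {ρ = ρ} [] hρ = cong (_+ inv ρ) (smaller-none hρ)
    inv-join {t ∷ τ} {ρ} (m<t ∷ hτ) hρ = begin
      smaller t (τ ++ m ∷ ρ) + inv (τ ++ m ∷ ρ)
        ≡⟨ cong₂ _+_ (trans (smaller-++ t τ (m ∷ ρ)) (cong (smaller t τ +_) (smaller-∷-< m<t ρ)))
                     (inv-join hτ hρ) ⟩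
      (smaller t τ + suc (smaller t ρ)) + (crossInv τ ρ + ((length τ + inv τ) + inv ρ))
        ≡⟨ solve 6 (λ a b c d e f →
             (a :+ (con 1 :+ b)) :+ (c :+ ((d :+ e) :+ f)) :=
             (b :+ c) :+ ((con 1 :+ d :+ (a :+ e)) :+ f)) refl
             (smaller t τ) (smaller t ρ) (crossInv τ ρ) (length τ) (inv τ) (inv ρ) ⟩
      (smaller t ρ + crossInv τ ρ) + ((suc (length τ) + (smaller t τ + inv τ)) + inv ρ) ∎
      where
      open ≡-Reasoning
      open import Data.Nat.Solver using (module +-*-Solver)
      open +-*-Solver using (solve; _:=_; _:+_; con)

    allB-above : ∀ {ρ} → All (m <_) ρ → allB (m <ᵇ_) ρ ≡ true
    allB-above [] = refl
    allB-above (m<r ∷ h) rewrite <ᵇ-true m<r = allB-above h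

    allB-fails : ∀ {t} τ ρ → m < t → allB (t <ᵇ_) (τ ++ m ∷ ρ) ≡ false
    allB-fails [] ρ m<t rewrite <ᵇ-false (ℕₚ.<⇒≤ m<t) = refl
    allB-fails (s ∷ τ) ρ m<t = trans (cong (_ ∧_) (allB-fails τ ρ m<t)) (∧-zeroʳ _)

    falses : List ℕ → List Bool
    falses = map (λ _ → false)

    rlFlags-join : ∀ {τ ρ} → All (m <_) τ → All (m <_) ρ →
      rlFlags (τ ++ m ∷ ρ) ≡ falses τ ++ true ∷ rlFlags ρ
    rlFlags-join [] hρ = cong (_∷ _) (allB-above hρ)
    rlFlags-join {_ ∷ τ} {ρ} (m<t ∷ hτ) hρ = cong₂ _∷_ (allB-fails τ ρ m<t) (rlFlags-join hτ hρ)

    count-falses : ∀ τ bs → count (falses τ ++ bs) ≡ count bs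
    count-falses [] bs = refl
    count-falses (_ ∷ τ) bs = count-falses τ bs

    -- With no bar before it, no letter of τ and not even the right-to-left minimum `m` can be
    -- isolated. The bar after `m` restarts the scan of ρ as at the beginning of a word.
    isolAux-falses : ∀ τ fs →
      isolAux false (falses τ ++ true ∷ fs) ≡ falses τ ++ false ∷ isolAux true fs
    isolAux-falses [] fs = refl
    isolAux-falses (_ ∷ τ) fs = cong (false ∷_) (isolAux-falses τ fs)

    iascAux-above : ∀ {ρ} → All (m <_) ρ → ∀ fs → iascAux m ρ fs ≡ iascAux 0 ρ fs
    iascAux-above [] fs = refl
    iascAux-above (_ ∷ _) [] = refl
    iascAux-above (m<r ∷ h) (f ∷ fs) rewrite <ᵇ-false (ℕₚ.<⇒≤ m<r) = refl

    iascAux-join : ∀ {t τ ρ} → m < t → All (m <_) τ → All (m <_) ρ → ∀ fs →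
      iascAux t (τ ++ m ∷ ρ) (falses τ ++ false ∷ fs) ≡ iascAux t τ (falses τ) + iascAux 0 ρ fs
    iascAux-join m<t [] hρ fs rewrite <ᵇ-true m<t = iascAux-above hρ fs
    iascAux-join {t} {s ∷ τ} m<t (m<s ∷ hτ) hρ fs =
      trans (cong (i +_) (iascAux-join m<s hτ hρ fs)) (sym (ℕₚ.+-assoc i _ _))
      where i = if not (s <ᵇ t) ∧ true then 1 else 0

    RLmin-join : ∀ {τ ρ} → All (m <_) τ → All (m <_) ρ → RLmin (τ ++ m ∷ ρ) ≡ suc (RLmin ρ)
    RLmin-join {τ} hτ hρ = trans (cong count (rlFlags-join hτ hρ)) (count-falses τ _)

    isolFlags-[]-join : ∀ {ρ} → All (m <_) ρ → isolFlags (m ∷ ρ) ≡ true ∷ isolFlags ρ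
    isolFlags-[]-join hρ = cong (isolAux true) (rlFlags-join [] hρ)

    isolFlags-∷-join : ∀ {t τ ρ} → All (m <_) (t ∷ τ) → All (m <_) ρ →
      isolFlags (t ∷ τ ++ m ∷ ρ) ≡ falses (t ∷ τ) ++ false ∷ isolFlags ρ
    isolFlags-∷-join {τ = τ} hτ hρ =
      trans (cong (isolAux true) (rlFlags-join hτ hρ)) (cong (false ∷_) (isolAux-falses τ _))

    isol-[]-join : ∀ {ρ} → All (m <_) ρ → isol (m ∷ ρ) ≡ suc (isol ρ)
    isol-[]-join hρ = cong count (isolFlags-[]-join hρ)

    isol-∷-join : ∀ {t τ ρ} → All (m <_) (t ∷ τ) → All (m <_) ρ → isol (t ∷ τ ++ m ∷ ρ) ≡ isol ρ
    isol-∷-join {t} {τ} hτ hρ =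
      trans (cong count (isolFlags-∷-join hτ hρ)) (count-falses (t ∷ τ) _)

    iasc-[]-join : ∀ {ρ} → All (m <_) ρ → iasc (m ∷ ρ) ≡ iasc ρ
    iasc-[]-join {ρ} hρ = trans (cong (iascAux 0 (m ∷ ρ)) (isolFlags-[]-join hρ)) (iascAux-above hρ _)

    -- The successor is the ascent from σ₀ = 0 into `t`, which is not isolated since it exceeds the
    -- later `m`. The step into `m` is a descent and adds nothing.
    iasc-∷-join : ∀ {t τ ρ} → All (m <_) (t ∷ τ) → All (m <_) ρ →
      iasc (t ∷ τ ++ m ∷ ρ) ≡ suc (iascAux t τ (falses τ)) + iasc ρ
    iasc-∷-join {t} {τ} {ρ} hτ@(m<t ∷ hτ′) hρ =
      trans (cong (iascAux 0 (t ∷ τ ++ m ∷ ρ)) (isolFlags-∷-join hτ hρ))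
            (cong suc (iascAux-join m<t hτ′ hρ _))

    adjDesc-++ : ∀ τ σ → adjDesc (τ ++ m ∷ σ) ≡ adjDesc (τ ∷ʳ m) + adjDesc (m ∷ σ)
    adjDesc-++ [] σ = refl
    adjDesc-++ (t ∷ []) σ = cong (_+ adjDesc (m ∷ σ)) (sym (ℕₚ.+-identityʳ _))
    adjDesc-++ (t ∷ s ∷ τ) σ =
      trans (cong (d +_) (adjDesc-++ (s ∷ τ) σ)) (sym (ℕₚ.+-assoc d _ _))
      where d = if s <ᵇ t then 1 else 0

    -- A nonempty ρ has at least the final descent to 0, so `des ρ ∸ 1` loses nothing. For empty ρ
    -- the subtraction truncates to 0, and the one descent is from `m` to 0. Thus the exponent des -
    -- 1 is additive at the cut in both cases.
    adjDesc-above : ∀ {ρ} → 0 < m → All (m <_) ρ → adjDesc (m ∷ ρ ∷ʳ 0) ≡ suc (des ρ ∸ 1)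
    adjDesc-above 0<m [] rewrite <ᵇ-true 0<m = refl
    adjDesc-above {r ∷ ρ} 0<m (m<r ∷ hρ) rewrite <ᵇ-false (ℕₚ.<⇒≤ m<r) =
      positive (ℕₚ.<-trans 0<m m<r) (All.map (ℕₚ.<-trans 0<m) hρ)
      where
      positive : ∀ {r ρ} → 0 < r → All (0 <_) ρ → adjDesc (r ∷ ρ ∷ʳ 0) ≡ suc (adjDesc (r ∷ ρ ∷ʳ 0) ∸ 1)
      positive 0<r [] rewrite <ᵇ-true 0<r = refl
      positive {r} {s ∷ ρ} 0<r (0<s ∷ h) with s <ᵇ r
      ... | true = refl
      ... | false = positive 0<s h

    des-join : ∀ {τ ρ} → 0 < m → All (m <_) ρ →
      des (τ ++ m ∷ ρ) ∸ 1 ≡ adjDesc (0 ∷ τ ∷ʳ m) + (des ρ ∸ 1)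
    des-join {τ} {ρ} 0<m hρ = cong (_∸ 1) (begin
      adjDesc (0 ∷ (τ ++ m ∷ ρ) ∷ʳ 0)
        ≡⟨ cong (λ σ → adjDesc (0 ∷ σ)) (++-assoc τ (m ∷ ρ) (0 ∷ [])) ⟩
      adjDesc (0 ∷ τ ++ m ∷ (ρ ∷ʳ 0))
        ≡⟨ adjDesc-++ (0 ∷ τ) (ρ ∷ʳ 0) ⟩
      adjDesc (0 ∷ τ ∷ʳ m) + adjDesc (m ∷ ρ ∷ʳ 0)
        ≡⟨ cong (adjDesc (0 ∷ τ ∷ʳ m) +_) (adjDesc-above 0<m hρ) ⟩
      adjDesc (0 ∷ τ ∷ʳ m) + suc (des ρ ∸ 1)
        ≡⟨ ℕₚ.+-suc _ _ ⟩
      suc (adjDesc (0 ∷ τ ∷ʳ m) + (des ρ ∸ 1)) ∎)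
      where open ≡-Reasoning

open Words

-- Sums over permutations

module ListSums {c ℓ} (S : CommutativeRing c ℓ) where
  open CommutativeRing S
  open Algebra.Properties.CommutativeSemigroup
    (CommutativeRing.+-commutativeSemigroup S) using (interchange)
  open Relation.Binary.Reasoning.Setoid setoid

  sumOver : ∀ {a} {A : Set a} → (A → Carrier) → List A → Carrier
  sumOver f = foldr (λ a acc → f a + acc) 0#

  module _ {a} {A : Set a} where

    sumOver-cong : ∀ {f g : A → Carrier} {L} → All (λ a → f a ≈ g a) L → sumOver f L ≈ sumOver g L
    sumOver-cong [] = refl
    sumOver-cong (p ∷ ps) = +-cong p (sumOver-cong ps)

    sumOver-++ : ∀ (f : A → Carrier) L M → sumOver f (L ++ M) ≈ sumOver f L + sumOver f M
    sumOver-++ f [] M = sym (+-identityˡ _)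
    sumOver-++ f (a ∷ L) M = trans (+-congˡ (sumOver-++ f L M)) (sym (+-assoc _ _ _))

    sumOver-+ : ∀ (f g : A → Carrier) L → sumOver (λ a → f a + g a) L ≈ sumOver f L + sumOver g L
    sumOver-+ f g [] = sym (+-identityˡ _)
    sumOver-+ f g (a ∷ L) = trans (+-congˡ (sumOver-+ f g L)) (interchange _ _ _ _)

    sumOver-*ˡ : ∀ r (f : A → Carrier) L → sumOver (λ a → r * f a) L ≈ r * sumOver f L
    sumOver-*ˡ r f [] = sym (zeroʳ r)
    sumOver-*ˡ r f (a ∷ L) = trans (+-congˡ (sumOver-*ˡ r f L)) (sym (distribˡ _ _ _))

  module _ {a b} {A : Set a} {B : Set b} (f : B → Carrier) where

    sumOver-map : ∀ (h : A → B) L → sumOver f (map h L) ≈ sumOver (f ∘ h) L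
    sumOver-map h [] = refl
    sumOver-map h (a ∷ L) = +-congˡ (sumOver-map h L)

    sumOver-concatMap : ∀ (h : A → List B) L →
      sumOver f (concatMap h L) ≈ sumOver (sumOver f ∘ h) L
    sumOver-concatMap h [] = refl
    sumOver-concatMap h (a ∷ L) =
      trans (sumOver-++ f (h a) (concatMap h L)) (+-congˡ (sumOver-concatMap h L))

-- The q-binomial convolution as a sum over cuts.

module Splitting {c ℓ} (S : CommutativeRing c ℓ) (q : CommutativeRing.Carrier S) where
  open CommutativeRing S
  open Thm S using (pow)
  open Powers S
  open ListSums S
  open Algebra.Solver.Ring.NaturalCoefficients.Default commutativeSemiring
  open Relation.Binary.Reasoning.Setoid setoid

  -- Equals Σ_j [n choose j]_q a_j b_{n-j}, by the q-Pascal rule.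
  binomialConv : ℕ → (ℕ → Carrier) → (ℕ → Carrier) → Carrier
  binomialConv zero a b = a 0 * b 0
  binomialConv (suc n) a b =
    binomialConv n (a ∘ suc) (λ j → pow q j * b j) + binomialConv n a (b ∘ suc)

  -- This replaces standardization: a sum over the words on a subset of labels sees only the size of
  -- the subset.
  SumsByLength : (List ℕ → Carrier) → (ℕ → Carrier) → List ℕ → Set ℓ
  SumsByLength f a L = ∀ {M} → M ⊆ L → sumOver f (permutationsOf M) ≈ a (length M)

  splitWeight : (f g : List ℕ → Carrier) → List ℕ × List ℕ → Carrier
  splitWeight f g (τ , ρ) = pow q (crossInv τ ρ) * (f τ * g ρ)

  -- Induction removes the largest letter `m`. Placed on the left, it turns `f` into its sum over
  -- insertions and adds one cross inversion per letter of ρ, a factor absorbed into `g`; placed on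
  -- the right, it acts on `g` alone. The functions change at each step, so the induction must be
  -- general in all of them.
  sumOver-splits : ∀ {L f g a b} → AllPairs _>_ L → SumsByLength f a L → SumsByLength g b L →
    sumOver (splitWeight f g) (splits L) ≈ binomialConv (length L) a b
  sumOver-splits {[]} {f} {g} {a} {b} _ Σf Σg = begin
    1# * (f [] * g []) + 0#        ≈⟨ +-identityʳ _ ⟩
    1# * (f [] * g [])             ≈⟨ *-identityˡ _ ⟩
    f [] * g []                    ≈⟨ *-cong (+-identityʳ _) (+-identityʳ _) ⟨
    (f [] + 0#) * (g [] + 0#)      ≈⟨ *-cong (Σf []) (Σg []) ⟩
    a 0 * b 0                      ∎
  sumOver-splits {m ∷ L} {f} {g} {a} {b} (L<m ∷ dec) Σf Σg = begin
    sumOver (splitWeight f g) (splits (m ∷ L))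
      ≈⟨ sumOver-concatMap (splitWeight f g) (insertInto m) (splits L) ⟩
    sumOver (sumOver (splitWeight f g) ∘ insertInto m) (splits L)
      ≈⟨ sumOver-cong (All.map (λ {(τ , ρ)} (τ<m , ρ<m) → insertion τ ρ τ<m ρ<m) (splits-All L<m)) ⟩
    sumOver (λ τρ → splitWeight f⁺ g′ τρ + splitWeight f g⁺ τρ) (splits L)
      ≈⟨ sumOver-+ (splitWeight f⁺ g′) (splitWeight f g⁺) (splits L) ⟩
    sumOver (splitWeight f⁺ g′) (splits L) + sumOver (splitWeight f g⁺) (splits L)
      ≈⟨ +-cong
           (sumOver-splits dec
             (λ {M} s → trans (sym (sumOver-concatMap f (insertEverywhere m) (permutationsOf M))) (Σf (≡.refl ∷ s)))
             (λ {M} s → trans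
               (sumOver-cong (All.map (λ eq → *-congʳ (reflexive (≡.cong (pow q) eq))) (permutationsOf-length M)))
               (trans (sumOver-*ˡ _ g (permutationsOf M)) (*-congˡ (Σg (skip m s))))))
           (sumOver-splits dec
             (λ s → Σf (skip m s))
             (λ {M} s → trans (sym (sumOver-concatMap g (insertEverywhere m) (permutationsOf M))) (Σg (≡.refl ∷ s)))) ⟩
    binomialConv (length L) (a ∘ suc) (λ j → pow q j * b j) + binomialConv (length L) a (b ∘ suc) ∎
    where
    f⁺ g⁺ g′ : List ℕ → Carrier
    f⁺ τ = sumOver f (insertEverywhere m τ)
    g⁺ ρ = sumOver g (insertEverywhere m ρ)
    g′ ρ = pow q (length ρ) * g ρ

    insertion : ∀ τ ρ → All (_< m) τ → All (_< m) ρ →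
      sumOver (splitWeight f g) (insertInto m (τ , ρ)) ≈ splitWeight f⁺ g′ (τ , ρ) + splitWeight f g⁺ (τ , ρ)
    insertion τ ρ τ<m ρ<m = begin
      sumOver (splitWeight f g) (insertInto m (τ , ρ))
        ≈⟨ sumOver-++ (splitWeight f g) (map (_, ρ) (insertEverywhere m τ)) _ ⟩
      sumOver (splitWeight f g) (map (_, ρ) (insertEverywhere m τ)) + sumOver (splitWeight f g) (map (τ ,_) (insertEverywhere m ρ))
        ≈⟨ +-cong (sumOver-map (splitWeight f g) (_, ρ) (insertEverywhere m τ))
                  (sumOver-map (splitWeight f g) (τ ,_) (insertEverywhere m ρ)) ⟩
      sumOver (λ τ′ → splitWeight f g (τ′ , ρ)) (insertEverywhere m τ) + sumOver (λ ρ′ → splitWeight f g (τ , ρ′)) (insertEverywhere m ρ)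
        ≈⟨ +-cong
             (sumOver-cong (All.map (λ {τ′} eq → left τ′ eq) (crossInv-insertˡ ρ<m τ)))
             (sumOver-cong (All.map (λ {ρ′} eq → right ρ′ eq) (crossInv-insertʳ τ<m ρ))) ⟩
      sumOver (λ τ′ → pow q (crossInv τ ρ) * g′ ρ * f τ′) (insertEverywhere m τ) + sumOver (λ ρ′ → pow q (crossInv τ ρ) * f τ * g ρ′) (insertEverywhere m ρ)
        ≈⟨ +-cong (sumOver-*ˡ _ f (insertEverywhere m τ)) (sumOver-*ˡ _ g (insertEverywhere m ρ)) ⟩
      pow q (crossInv τ ρ) * g′ ρ * f⁺ τ + pow q (crossInv τ ρ) * f τ * g⁺ ρ
        ≈⟨ solve 5 (λ p g f f′ g′ → p :* g :* f :+ p :* f′ :* g′ := p :* (f :* g) :+ p :* (f′ :* g′))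
             refl (pow q (crossInv τ ρ)) (g′ ρ) (f⁺ τ) (f τ) (g⁺ ρ) ⟩
      splitWeight f⁺ g′ (τ , ρ) + splitWeight f g⁺ (τ , ρ) ∎
      where
      left : ∀ τ′ → crossInv τ′ ρ ≡ length ρ ℕ.+ crossInv τ ρ →
        splitWeight f g (τ′ , ρ) ≈ pow q (crossInv τ ρ) * g′ ρ * f τ′
      left τ′ eq = begin
        pow q (crossInv τ′ ρ) * (f τ′ * g ρ)
          ≡⟨ ≡.cong (λ k → pow q k * (f τ′ * g ρ)) eq ⟩
        pow q (length ρ ℕ.+ crossInv τ ρ) * (f τ′ * g ρ)
          ≈⟨ *-congʳ (pow-+ q (length ρ) _) ⟩
        pow q (length ρ) * pow q (crossInv τ ρ) * (f τ′ * g ρ)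
          ≈⟨ solve 4 (λ a b f g → a :* b :* (f :* g) := b :* (a :* g) :* f)
               refl (pow q (length ρ)) (pow q (crossInv τ ρ)) (f τ′) (g ρ) ⟩
        pow q (crossInv τ ρ) * g′ ρ * f τ′ ∎
      right : ∀ ρ′ → crossInv τ ρ′ ≡ crossInv τ ρ →
        splitWeight f g (τ , ρ′) ≈ pow q (crossInv τ ρ) * f τ * g ρ′
      right ρ′ eq = trans (*-congʳ (reflexive (≡.cong (pow q) eq))) (sym (*-assoc _ _ _))

  sumOver-∷ʳ : ∀ {L m f g h a b} → AllPairs _>_ (L ∷ʳ m) →
    (∀ {τ ρ} → All (m <_) τ → All (m <_) ρ → h (τ ++ m ∷ ρ) ≈ splitWeight f g (τ , ρ)) →
    SumsByLength f a L → SumsByLength g b L →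
    sumOver h (permutationsOf (L ∷ʳ m)) ≈ binomialConv (length L) a b
  sumOver-∷ʳ {L} {m} {f} {g} {h} {a} {b} dec h-join Σf Σg = begin
    sumOver h (permutationsOf (L ∷ʳ m))
      ≡⟨ ≡.cong (sumOver h) (permutationsOf-∷ʳ L m) ⟩
    sumOver h (map (join m) (splits L))
      ≈⟨ sumOver-map h (join m) (splits L) ⟩
    sumOver (h ∘ join m) (splits L)
      ≈⟨ sumOver-cong (All.map (λ (hτ , hρ) → h-join hτ hρ) (splits-All (proj₂ (AllPairs-∷ʳ⁻ L dec)))) ⟩
    sumOver (splitWeight f g) (splits L)
      ≈⟨ sumOver-splits (proj₁ (AllPairs-∷ʳ⁻ L dec)) Σf Σg ⟩
    binomialConv (length L) a b ∎

length-∷ʳ : ∀ {a} {A : Set a} (xs : List A) {x} → length (xs ∷ʳ x) ≡ suc (length xs)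
length-∷ʳ xs = ≡.trans (length-++ xs) (ℕₚ.+-comm (length xs) 1)

-- The decreasing order puts the smallest label last, where the cut is made; positivity keeps the
-- boundary value 0 below every letter.
LabelSet : List ℕ → Set
LabelSet L = AllPairs _>_ L × All (0 <_) L

LabelSet-resp-⊆ : ∀ {M L} → M ⊆ L → LabelSet L → LabelSet M
LabelSet-resp-⊆ s (dec , pos) = AllPairs-resp-⊆ s dec , All-resp-⊆ s pos

LabelSet-descending : ∀ n → LabelSet (descending n)
LabelSet-descending n =
  AllPairsₚ.applyDownFrom⁺₁ suc n (λ j<i _ → s≤s j<i) , Allₚ.applyDownFrom⁺₂ suc n (λ _ → s≤s z≤n)

-- Multiplicativity of the weights at the cut and the resulting recurrences.

module Weights {c ℓ} (S : CommutativeRing c ℓ) (q x y : CommutativeRing.Carrier S) where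
  open CommutativeRing S
  open Thm S using (pow)
  open Powers S
  open ListSums S
  open Splitting S q
  open Algebra.Solver.Ring.NaturalCoefficients.Default commutativeSemiring
  open Relation.Binary.Reasoning.Setoid setoid

  -- x per ascent and y per descent along the path p, τ₁, …, τₖ, 0.
  pathWeight : ℕ → List ℕ → Carrier
  pathWeight p [] = y
  pathWeight p (a ∷ τ) = (if a <ᵇ p then y else x) * pathWeight a τ

  eulerianWeight : List ℕ → Carrier
  eulerianWeight σ = pow q (inv σ) * pathWeight 0 σ

  -- The contribution of the entries before the smallest one, where s replaces
  -- the value on the empty word.
  prefixWeight : Carrier → List ℕ → Carrier
  prefixWeight s [] = s
  prefixWeight s τ@(_ ∷ _) = pow q (length τ) * eulerianWeight τ

  permSum : (List ℕ → Carrier) → ℕ → Carrier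
  permSum h n = sumOver h (perms n)

  prefixSum : Carrier → ℕ → Carrier
  prefixSum s zero = s
  prefixSum s (suc n) = pow q (suc n) * permSum eulerianWeight (suc n)

  ByLength : (List ℕ → Carrier) → ℕ → Set ℓ
  ByLength h n = ∀ {M} → length M ≤ n → LabelSet M →
    sumOver h (permutationsOf M) ≈ permSum h (length M)

  prefix-sums : ∀ s {L} → SumsByLength eulerianWeight (permSum eulerianWeight) L →
    SumsByLength (prefixWeight s) (prefixSum s) L
  prefix-sums s Σγ {[]} _ = +-identityʳ s
  prefix-sums s Σγ {M@(_ ∷ _)} M⊆L = begin
    sumOver (prefixWeight s) (permutationsOf M)
      ≈⟨ sumOver-cong (All.map (λ {τ} → nonempty τ) (permutationsOf-length M)) ⟩
    sumOver (λ τ → pow q (length M) * eulerianWeight τ) (permutationsOf M)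
      ≈⟨ sumOver-*ˡ (pow q (length M)) eulerianWeight (permutationsOf M) ⟩
    pow q (length M) * sumOver eulerianWeight (permutationsOf M)
      ≈⟨ *-congˡ (Σγ M⊆L) ⟩
    pow q (length M) * permSum eulerianWeight (length M) ∎
    where
    nonempty : ∀ τ → length τ ≡ length M → prefixWeight s τ ≈ pow q (length M) * eulerianWeight τ
    nonempty (_ ∷ _) eq = *-congʳ (reflexive (≡.cong (pow q) eq))

  -- One argument serves both series: `s` is the weight of an empty prefix and `κ` that of the cut
  -- letter. The pair (x, 1) gives C, and (z, β) gives G.
  module Recurrence (s κ : Carrier) (h : List ℕ → Carrier)
    (h-join : ∀ {m τ ρ} → 0 < m → All (m <_) τ → All (m <_) ρ →
      h (τ ++ m ∷ ρ) ≈ splitWeight (prefixWeight s) (λ ρ → κ * h ρ) (τ , ρ))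
    where

    recurrence-at : ∀ n → ByLength eulerianWeight n → ByLength h n →
      ∀ M → length M ≡ suc n → LabelSet M →
      sumOver h (permutationsOf M) ≈ binomialConv n (prefixSum s) (λ j → κ * permSum h j)
    -- In a decreasing list the last label `m` is the smallest, hence the letter to cut at.
    recurrence-at n Σγ Σh M M≡n (dec , pos) with initLast M
    ... | L ∷ʳ′ m with ≡.refl ← ℕₚ.suc-injective (≡.trans (≡.sym (length-∷ʳ L)) M≡n) =
      sumOver-∷ʳ dec (h-join (proj₂ (Allₚ.∷ʳ⁻ pos)))
        (prefix-sums s (λ M⊆L → Σγ (Sublistₚ.length-mono-≤ M⊆L) (LabelSet-resp-⊆ M⊆L labels)))
        (λ {M} M⊆L → trans (sumOver-*ˡ κ h (permutationsOf M))
          (*-congˡ (Σh (Sublistₚ.length-mono-≤ M⊆L) (LabelSet-resp-⊆ M⊆L labels))))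
      where
      labels : LabelSet L
      labels = proj₁ (AllPairs-∷ʳ⁻ L dec) , proj₁ (Allₚ.∷ʳ⁻ pos)

    recurrence : ∀ n → ByLength eulerianWeight n → ByLength h n →
      permSum h (suc n) ≈ binomialConv n (prefixSum s) (λ j → κ * permSum h j)
    recurrence n Σγ Σh = trans
      (reflexive (≡.cong (sumOver h) (perms≡permutationsOf (suc n))))
      (recurrence-at n Σγ Σh (descending (suc n)) (length-applyDownFrom suc (suc n)) (LabelSet-descending (suc n)))

    -- The recurrence expresses the sum over n+1 labels through sums over at most n labels, and its
    -- right side no longer mentions the labels; so any two label sets of size n+1 give the same
    -- sum. The hypothesis may use the induction hypothesis for `h`, which lets `eulerianWeight`
    -- itself be taken for `h`.
    byLength : (∀ n → ByLength h n → ByLength eulerianWeight n) → ∀ n → ByLength h n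
    byLength Σγ zero {[]} _ _ = refl
    byLength Σγ (suc n) {M} M≤1+n labels with ℕₚ.m≤n⇒m<n∨m≡n M≤1+n
    ... | inj₁ (s≤s M≤n) = byLength Σγ n M≤n labels
    ... | inj₂ M≡1+n = begin
      sumOver h (permutationsOf M)
        ≈⟨ recurrence-at n (Σγ n Σh) Σh M M≡1+n labels ⟩
      binomialConv n (prefixSum s) (λ j → κ * permSum h j)
        ≈⟨ recurrence n (Σγ n Σh) Σh ⟨
      permSum h (suc n)
        ≡⟨ ≡.cong (permSum h) M≡1+n ⟨
      permSum h (length M) ∎
      where
      Σh : ByLength h n
      Σh = byLength Σγ n

  pathWeight-above : ∀ {m ρ} → All (m <_) ρ → pathWeight m ρ ≡ pathWeight 0 ρ
  pathWeight-above [] = ≡.refl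
  pathWeight-above (m<r ∷ _) rewrite <ᵇ-false (ℕₚ.<⇒≤ m<r) = ≡.refl

  -- The path leaves τ by a descent whether it goes to `m` or to the final 0, so this step pays the
  -- closing y of the first factor; leaving `m` it sees the letters of ρ from below, as 0 does.
  pathWeight-join : ∀ {m p τ ρ} → m < p → All (m <_) τ → All (m <_) ρ →
    pathWeight p (τ ++ m ∷ ρ) ≈ pathWeight p τ * pathWeight 0 ρ
  pathWeight-join m<p [] hρ rewrite <ᵇ-true m<p = *-congˡ (reflexive (pathWeight-above hρ))
  pathWeight-join m<p (m<t ∷ hτ) hρ =
    trans (*-congˡ (pathWeight-join m<t hτ hρ)) (sym (*-assoc _ _ _))

  inv-pow : ∀ {m τ ρ} → All (m <_) τ → All (m <_) ρ → pow q (inv (τ ++ m ∷ ρ)) ≈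
    pow q (crossInv τ ρ) * (pow q (length τ) * pow q (inv τ) * pow q (inv ρ))
  inv-pow {m} {τ} {ρ} hτ hρ = begin
    pow q (inv (τ ++ m ∷ ρ))
      ≡⟨ ≡.cong (pow q) (inv-join hτ hρ) ⟩
    pow q (crossInv τ ρ ℕ.+ ((length τ ℕ.+ inv τ) ℕ.+ inv ρ))
      ≈⟨ pow-+ q (crossInv τ ρ) _ ⟩
    pow q (crossInv τ ρ) * pow q ((length τ ℕ.+ inv τ) ℕ.+ inv ρ)
      ≈⟨ *-congˡ (trans (pow-+ q (length τ ℕ.+ inv τ) _) (*-congʳ (pow-+ q (length τ) (inv τ)))) ⟩
    pow q (crossInv τ ρ) * (pow q (length τ) * pow q (inv τ) * pow q (inv ρ)) ∎

  eulerian-join : ∀ {m τ ρ} → 0 < m → All (m <_) τ → All (m <_) ρ →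
    eulerianWeight (τ ++ m ∷ ρ) ≈ splitWeight (prefixWeight x) (λ ρ → 1# * eulerianWeight ρ) (τ , ρ)
  eulerian-join {m} {[]} {ρ} 0<m [] hρ = begin
    pow q (inv (m ∷ ρ)) * (x * pathWeight m ρ)
      ≈⟨ *-cong (inv-pow [] hρ) (*-congˡ (reflexive (pathWeight-above hρ))) ⟩
    1# * (1# * 1# * pow q (inv ρ)) * (x * pathWeight 0 ρ)
      ≈⟨ solve 3 (λ i x w → con 1 :* (con 1 :* con 1 :* i) :* (x :* w) :=
           con 1 :* (x :* (con 1 :* (i :* w))))
           refl (pow q (inv ρ)) x (pathWeight 0 ρ) ⟩
    1# * (x * (1# * eulerianWeight ρ)) ∎
  eulerian-join {m} {t ∷ τ} {ρ} 0<m hτ@(m<t ∷ hτ′) hρ = begin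
    pow q (inv (t ∷ τ ++ m ∷ ρ)) * (x * pathWeight t (τ ++ m ∷ ρ))
      ≈⟨ *-cong (inv-pow hτ hρ) (*-congˡ (pathWeight-join m<t hτ′ hρ)) ⟩
    cr * (ln * i * j) * (x * (pathWeight t τ * pathWeight 0 ρ))
      ≈⟨ solve 7 (λ cr ln i j x v w → cr :* (ln :* i :* j) :* (x :* (v :* w)) :=
           cr :* (ln :* (i :* (x :* v)) :* (con 1 :* (j :* w))))
           refl cr ln i j x (pathWeight t τ) (pathWeight 0 ρ) ⟩
    cr * (ln * eulerianWeight (t ∷ τ) * (1# * eulerianWeight ρ)) ∎
    where
    cr = pow q (crossInv (t ∷ τ) ρ)
    ln = pow q (length (t ∷ τ))
    i = pow q (inv (t ∷ τ))
    j = pow q (inv ρ)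

  -- The descent into m accounts for the final y of pathWeight.
  pathWeight-counts : ∀ {m t τ} → m < t → All (m <_) τ →
    pow x (iascAux t τ (falses {m} τ)) * pow y (adjDesc (t ∷ τ ∷ʳ m)) ≈ pathWeight t τ
  pathWeight-counts m<t [] rewrite <ᵇ-true m<t = trans (*-identityˡ _) (*-identityʳ y)
  pathWeight-counts {m} {t} {s ∷ τ} m<t (m<s ∷ hτ) with s <ᵇ t
  ... | true = trans
    (solve 3 (λ a y b → a :* (y :* b) := y :* (a :* b)) refl
      (pow x (iascAux s τ (falses {m} τ))) y (pow y (adjDesc (s ∷ τ ∷ʳ m))))
    (*-congˡ (pathWeight-counts m<s hτ))
  ... | false = trans (*-assoc _ _ _) (*-congˡ (pathWeight-counts m<s hτ))

  private
    module Eulerian = Recurrence x 1# eulerianWeight eulerian-join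

  eulerian-byLength : ∀ n → ByLength eulerianWeight n
  eulerian-byLength = Eulerian.byLength (λ _ Σγ → Σγ)

  eulerian-recurrence : ∀ n → permSum eulerianWeight (suc n) ≈
    binomialConv n (prefixSum x) (λ j → 1# * permSum eulerianWeight j)
  eulerian-recurrence n = Eulerian.recurrence n (eulerian-byLength n) (eulerian-byLength n)

  module _ (z β : Carrier) where

    statWeight : List ℕ → Carrier
    statWeight σ = pow q (inv σ) *
      (pow x (iasc σ) * pow z (isol σ) * pow y (des σ ∸ 1) * pow β (RLmin σ))

    -- If τ is empty, `m` is isolated: it gives z and its ascent from 0 is not counted. Otherwise τ
    -- and `m` form one block with no isolated entry, so all ascents of τ count and its statistics
    -- reproduce the Eulerian path weight. In both cases `m` is one right-to-left minimum, whence β.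
    stat-join : ∀ {m τ ρ} → 0 < m → All (m <_) τ → All (m <_) ρ →
      statWeight (τ ++ m ∷ ρ) ≈ splitWeight (prefixWeight z) (λ ρ → β * statWeight ρ) (τ , ρ)
    stat-join {m} {[]} {ρ} 0<m [] hρ
      rewrite iasc-[]-join hρ | isol-[]-join hρ | des-join {τ = []} 0<m hρ | RLmin-join {τ = []} [] hρ = begin
      pow q (inv (m ∷ ρ)) * (pow x (iasc ρ) * (z * pow z (isol ρ)) * pow y (des ρ ∸ 1) * (β * pow β (RLmin ρ)))
        ≈⟨ *-congʳ (inv-pow [] hρ) ⟩
      1# * (1# * 1# * pow q (inv ρ)) * (pow x (iasc ρ) * (z * pow z (isol ρ)) * pow y (des ρ ∸ 1) * (β * pow β (RLmin ρ)))
        ≈⟨ solve 7 (λ j a z b d β r →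
             con 1 :* (con 1 :* con 1 :* j) :* (a :* (z :* b) :* d :* (β :* r)) :=
             con 1 :* (z :* (β :* (j :* (a :* b :* d :* r)))))
             refl (pow q (inv ρ)) (pow x (iasc ρ)) z (pow z (isol ρ)) (pow y (des ρ ∸ 1)) β (pow β (RLmin ρ)) ⟩
      1# * (z * (β * statWeight ρ)) ∎
    stat-join {m} {t ∷ τ} {ρ} 0<m hτ@(m<t ∷ hτ′) hρ
      rewrite iasc-∷-join hτ hρ | isol-∷-join hτ hρ | des-join {τ = t ∷ τ} 0<m hρ | RLmin-join hτ hρ = begin
      pow q (inv (t ∷ τ ++ m ∷ ρ)) *
        (x * pow x (asc ℕ.+ iasc ρ) * pow z (isol ρ) * pow y (dsc ℕ.+ (des ρ ∸ 1)) * (β * pow β (RLmin ρ)))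
        ≈⟨ *-cong (inv-pow hτ hρ) (*-congʳ (*-cong (*-congʳ (*-congˡ (pow-+ x asc _))) (pow-+ y dsc _))) ⟩
      cr * (ln * i * j) *
        (x * (pow x asc * pow x (iasc ρ)) * pow z (isol ρ) * (pow y dsc * pow y (des ρ ∸ 1)) * (β * pow β (RLmin ρ)))
        ≈⟨ solve 12 (λ cr ln i j x v a b w d β r →
             cr :* (ln :* i :* j) :* (x :* (v :* a) :* b :* (w :* d) :* (β :* r)) :=
             cr :* (ln :* (i :* (x :* (v :* w))) :* (β :* (j :* (a :* b :* d :* r)))))
             refl cr ln i j x (pow x asc) (pow x (iasc ρ)) (pow z (isol ρ)) (pow y dsc)
             (pow y (des ρ ∸ 1)) β (pow β (RLmin ρ)) ⟩
      cr * (ln * (i * (x * (pow x asc * pow y dsc))) * (β * statWeight ρ))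
        ≈⟨ *-congˡ (*-congʳ (*-congˡ (*-congˡ (*-congˡ (pathWeight-counts m<t hτ′))))) ⟩
      cr * (ln * eulerianWeight (t ∷ τ) * (β * statWeight ρ)) ∎
      where
      asc = iascAux t τ (falses {m} τ)
      dsc = adjDesc (t ∷ τ ∷ʳ m)
      cr = pow q (crossInv (t ∷ τ) ρ)
      ln = pow q (length (t ∷ τ))
      i = pow q (inv (t ∷ τ))
      j = pow q (inv ρ)

    private
      module Stat = Recurrence z β statWeight stat-join

    stat-recurrence : ∀ n → permSum statWeight (suc n) ≈
      binomialConv n (prefixSum z) (λ j → β * permSum statWeight j)
    stat-recurrence n = Stat.recurrence n (eulerian-byLength n)
      (Stat.byLength (λ n _ → eulerian-byLength n) n)

-- Generating functions

-- e stands for the coefficients 1/(q;q)ₙ of e_q.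
module GeneratingSeries {c ℓ} (S : CommutativeRing c ℓ) (q : CommutativeRing.Carrier S)
  (cancel : ∀ n {a b r} →
    CommutativeRing._≈_ S a (CommutativeRing._+_ S (CommutativeRing._*_ S (Thm.pow S q (suc n)) a) r) →
    CommutativeRing._≈_ S b (CommutativeRing._+_ S (CommutativeRing._*_ S (Thm.pow S q (suc n)) b) r) →
    CommutativeRing._≈_ S a b)
  (e : ℕ → CommutativeRing.Carrier S)
  (e₀≈1 : CommutativeRing._≈_ S (e 0) (CommutativeRing.1# S))
  (e-diff : qDifference._hasDifference_ S q e e)
  where
  open CommutativeRing S
  open Thm S using (pow; constQ)
  open PowerSeries S
  open Rescaling S
  open qDifference S q
  open Splitting S q
  open EulerianSolution S q
  open Algebra.Properties.CommutativeSemigroup *-commutativeSemigroup using (x∙yz≈y∙xz)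
  private module B = CommutativeRing seriesRing

  gf : (ℕ → Carrier) → Series
  gf a n = a n * e n

  gf-· : ∀ r a → gf (λ n → r * a n) ≋ constQ r ⊠ gf a
  gf-· r a = coeffwise (λ n → trans (*-assoc _ _ _) (sym (const-⊠ r (gf a) n)))

  gf-pow : ∀ a → gf (λ n → pow q n * a n) ≋ η (gf a)
  gf-pow a = coeffwise (λ n → *-assoc _ _ _)

  -- Since (1 - qⁿ⁺¹)eₙ₊₁ = eₙ, the q-difference of a q-exponential generating function shifts its
  -- coefficient sequence by one.
  gf-difference : ∀ a → gf a hasDifference gf (a ∘ suc)
  gf-difference a = fromCoeffs {g = gf (a ∘ suc)} (λ n → begin
    a (suc n) * e (suc n)
      ≈⟨ *-congˡ (toCoeffs {g = e} e-diff n) ⟩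
    a (suc n) * (pow q (suc n) * e (suc n) + e n)
      ≈⟨ distribˡ _ _ _ ⟩
    a (suc n) * (pow q (suc n) * e (suc n)) + gf (a ∘ suc) n
      ≈⟨ +-congʳ (x∙yz≈y∙xz _ _ _) ⟩
    pow q (suc n) * gf a (suc n) + gf (a ∘ suc) n ∎)
    where open Relation.Binary.Reasoning.Setoid setoid

  -- The substitution falls on only one factor: f(u)g(u) - f(qu)g(qu) = (f(u) - f(qu))g(qu) +
  -- f(u)(g(u) - g(qu)). This asymmetry is that of the q-Pascal rule in `binomialConv`.
  q-Leibniz : ∀ {f f₁ g g₁} → f hasDifference f₁ → g hasDifference g₁ →
    f ⊠ g hasDifference (f₁ ⊠ η g ⊞ f ⊠ g₁)
  q-Leibniz {f} {f₁} {g} {g₁} f-diff g-diff = begin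
    f ⊠ g
      ≈⟨ B.*-congˡ {f} g-diff ⟩
    f ⊠ (η g ⊞ (var ⊠ g₁))
      ≈⟨ B.distribˡ f (η g) (var ⊠ g₁) ⟩
    f ⊠ η g ⊞ f ⊠ (var ⊠ g₁)
      ≈⟨ B.+-congʳ {f ⊠ (var ⊠ g₁)} (B.*-congʳ {η g} f-diff) ⟩
    (η f ⊞ (var ⊠ f₁)) ⊠ η g ⊞ f ⊠ (var ⊠ g₁)
      ≈⟨ solve 6 (λ f′ u f₁ g′ f g₁ →
           (f′ :+ u :* f₁) :* g′ :+ f :* (u :* g₁) := f′ :* g′ :+ u :* (f₁ :* g′ :+ f :* g₁))
           B.refl (η f) var f₁ (η g) f g₁ ⟩
    η f ⊠ η g ⊞ (var ⊠ (f₁ ⊠ η g ⊞ f ⊠ g₁))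
      ≈⟨ B.+-congʳ {var ⊠ (f₁ ⊠ η g ⊞ f ⊠ g₁)} (scale-⊠ q f g) ⟨
    η (f ⊠ g) ⊞ (var ⊠ (f₁ ⊠ η g ⊞ f ⊠ g₁)) ∎
    where
    open Relation.Binary.Reasoning.Setoid B.setoid
    open Algebra.Solver.Ring.NaturalCoefficients.Default B.commutativeSemiring
      using (solve; _:=_; _:+_; _:*_)

  -- Both sides solve a = qⁿ⁺¹a + r with the same r: on the left by the recursion for `e` and the
  -- q-Pascal rule, on the right by the q-Leibniz rule. The induction hypothesis identifies the two
  -- values of r, and `cancel` concludes.
  gf-binomialConv : ∀ n a b → binomialConv n a b * e n ≈ (gf a ⊠ gf b) n
  gf-binomialConv zero a b = begin
    a 0 * b 0 * e 0          ≈⟨ *-assoc _ _ _ ⟩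
    a 0 * (b 0 * e 0)        ≈⟨ *-congʳ (trans (*-congˡ e₀≈1) (*-identityʳ _)) ⟨
    a 0 * e 0 * (b 0 * e 0)  ≈⟨ ⊠-zero (gf a) (gf b) ⟨
    (gf a ⊠ gf b) 0          ∎
    where open Relation.Binary.Reasoning.Setoid setoid
  gf-binomialConv (suc n) a b = cancel n
    (begin
      conv * e (suc n)
        ≈⟨ *-congˡ (toCoeffs {g = e} e-diff n) ⟩
      conv * (pow q (suc n) * e (suc n) + e n)
        ≈⟨ distribˡ _ _ _ ⟩
      conv * (pow q (suc n) * e (suc n)) + conv * e n
        ≈⟨ +-cong (x∙yz≈y∙xz _ _ _) (distribʳ _ _ _) ⟩
      pow q (suc n) * (conv * e (suc n)) + (binomialConv n (a ∘ suc) (λ j → pow q j * b j) * e n + binomialConv n a (b ∘ suc) * e n)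
        ≈⟨ +-congˡ (+-cong (gf-binomialConv n (a ∘ suc) (λ j → pow q j * b j)) (gf-binomialConv n a (b ∘ suc))) ⟩
      pow q (suc n) * (conv * e (suc n)) + ((gf (a ∘ suc) ⊠ gf (λ j → pow q j * b j)) n + (gf a ⊠ gf (b ∘ suc)) n)
        ≈⟨ +-congˡ (+-congʳ (coeff (B.*-congˡ {gf (a ∘ suc)} (gf-pow b)) n)) ⟩
      pow q (suc n) * (conv * e (suc n)) + ((gf (a ∘ suc) ⊠ η (gf b)) n + (gf a ⊠ gf (b ∘ suc)) n) ∎)
    (toCoeffs {g = gf (a ∘ suc) ⊠ η (gf b) ⊞ gf a ⊠ gf (b ∘ suc)}
      (q-Leibniz {f₁ = gf (a ∘ suc)} {g₁ = gf (b ∘ suc)} (gf-difference a) (gf-difference b)) n)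
    where
    conv = binomialConv (suc n) a b
    open Relation.Binary.Reasoning.Setoid setoid

  gf-recurrence : ∀ {h a b} → (∀ n → h (suc n) ≈ binomialConv n a b) →
    gf h hasDifference (gf a ⊠ gf b)
  gf-recurrence {h} {a} {b} h-rec =
    hasDifference-resp (coeffwise (λ n → trans (*-congʳ (h-rec n)) (gf-binomialConv n a b))) (gf-difference h)

  module _ {x y p : Carrier} (y+p≈x : y + p ≈ x) where
    open Weights S q x y

    eulerianSeries : Series
    eulerianSeries = gf (permSum eulerianWeight)

    eulerianSeries-zero : eulerianSeries 0 ≈ y
    eulerianSeries-zero = trans (*-cong (trans (+-identityʳ _) (*-identityˡ y)) e₀≈1) (*-identityʳ y)

    -- The factor qⁿ from the inversions with the cut letter produces C(uq). Only the constant term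
    -- differs, being `s` instead of y, and `r` makes up for it.
    prefixSeries : ∀ {r s} → y + r ≈ s → gf (prefixSum s) ≋ η eulerianSeries ⊞ constQ r
    prefixSeries {r} {s} y+r≈s = coeffwise λ where
      zero → trans (*-congˡ e₀≈1) (trans (*-identityʳ s) (sym
        (trans (+-congʳ (trans (*-identityˡ _) eulerianSeries-zero)) y+r≈s)))
      (suc n) → trans (*-assoc _ _ _) (sym (+-identityʳ _))

    eulerianSeries-difference :
      eulerianSeries hasDifference ((η eulerianSeries ⊞ constQ p) ⊠ eulerianSeries)
    eulerianSeries-difference = hasDifference-resp
      (B.*-cong (prefixSeries y+p≈x) (B.trans (gf-· 1# (permSum eulerianWeight)) (B.*-identityˡ eulerianSeries)))
      (gf-recurrence {permSum eulerianWeight} {prefixSum x} {λ j → 1# * permSum eulerianWeight j} eulerian-recurrence)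

    eulerianSeries-closed-form :
      constQ x ⊠ eulerianSeries ≋ constQ y ⊠ (scale p e ⊠ (eulerianSeries ⊞ constQ p))
    eulerianSeries-closed-form =
      eulerian cancel y+p≈x e₀≈1 e-diff eulerianSeries-zero eulerianSeries-difference

    module _ (z β : Carrier) where

      statSeries : Series
      statSeries = gf (permSum (statWeight z β))

      statSeries-zero : statSeries 0 ≈ 1#
      statSeries-zero = begin
        (1# * (1# * 1# * 1# * 1#) + 0#) * e 0 ≈⟨ *-cong (+-identityʳ _) e₀≈1 ⟩
        1# * (1# * 1# * 1# * 1#) * 1#         ≈⟨ solve 0 (con 1 :* (con 1 :* con 1 :* con 1 :* con 1) :* con 1 := con 1) refl ⟩
        1#                                    ∎
        where
        open Relation.Binary.Reasoning.Setoid setoid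
        open Algebra.Solver.Ring.NaturalCoefficients.Default commutativeSemiring
          using (solve; _:=_; _:*_; con)

      statSeries-difference : ∀ {r} → y + r ≈ z →
        statSeries hasDifference (constQ β ⊠ ((η eulerianSeries ⊞ constQ r) ⊠ statSeries))
      statSeries-difference {r} y+r≈z = hasDifference-resp
        (begin
          gf (prefixSum z) ⊠ gf (λ j → β * permSum (statWeight z β) j)
            ≈⟨ B.*-cong (prefixSeries y+r≈z) (gf-· β (permSum (statWeight z β))) ⟩
          (η eulerianSeries ⊞ constQ r) ⊠ (constQ β ⊠ statSeries)
            ≈⟨ solve 3 (λ a b c → a :* (b :* c) := b :* (a :* c)) B.refl (η eulerianSeries ⊞ constQ r) (constQ β) statSeries ⟩
          constQ β ⊠ ((η eulerianSeries ⊞ constQ r) ⊠ statSeries) ∎)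
        (gf-recurrence {permSum (statWeight z β)} {prefixSum z} {λ j → β * permSum (statWeight z β) j} (stat-recurrence z β))
        where
        open Relation.Binary.Reasoning.Setoid B.setoid
        open Algebra.Solver.Ring.NaturalCoefficients.Default B.commutativeSemiring
          using (solve; _:=_; _:*_)

-- The ring R[[q]]

-- Here m stands for -t.
module UnitComplement {c ℓ} (A : CommutativeRing c ℓ) where
  open CommutativeRing A
  open Algebra.Solver.Ring.NaturalCoefficients.Default commutativeSemiring
  open Relation.Binary.Reasoning.Setoid setoid

  solve-affine : ∀ {m t v a r} → m + t ≈ 0# → (1# + m) * v ≈ 1# → a ≈ t * a + r → a ≈ v * r
  solve-affine {m} {t} {v} {a} {r} m+t≈0 unit a-eq = begin
    a                        ≈⟨ *-identityˡ a ⟨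
    1# * a                   ≈⟨ *-congʳ unit ⟨
    (1# + m) * v * a         ≈⟨ solve 3 (λ m v a → (con 1 :+ m) :* v :* a := v :* (a :+ m :* a)) refl m v a ⟩
    v * (a + m * a)          ≈⟨ *-congˡ (+-congʳ a-eq) ⟩
    v * (t * a + r + m * a)  ≈⟨ solve 5 (λ v t a r m → v :* (t :* a :+ r :+ m :* a) := v :* ((m :+ t) :* a :+ r)) refl v t a r m ⟩
    v * ((m + t) * a + r)    ≈⟨ *-congˡ (+-congʳ (trans (*-congʳ m+t≈0) (zeroˡ a))) ⟩
    v * (0# + r)             ≈⟨ *-congˡ (+-identityˡ r) ⟩
    v * r                    ∎

  -- With m = -t, inserting pe = 1 gives (1-t)e′ = pe(1-t)e′ = e, because p(1-t)e′ = 1.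
  inverse-step : ∀ {m t p e e′} → m + t ≈ 0# → p * e ≈ 1# → p * (1# + m) * e′ ≈ 1# →
    e′ ≈ t * e′ + e
  inverse-step {m} {t} {p} {e} {e′} m+t≈0 pe≈1 pe′≈1 = begin
    e′                              ≈⟨ +-identityʳ e′ ⟨
    e′ + 0#                         ≈⟨ +-congˡ (trans (*-congʳ m+t≈0) (zeroˡ e′)) ⟨
    e′ + (m + t) * e′               ≈⟨ solve 3 (λ e′ m t → e′ :+ (m :+ t) :* e′ := t :* e′ :+ con 1 :* (con 1 :+ m) :* e′) refl e′ m t ⟩
    t * e′ + 1# * (1# + m) * e′     ≈⟨ +-congˡ (*-congʳ (*-congʳ pe≈1)) ⟨
    t * e′ + p * e * (1# + m) * e′  ≈⟨ +-congˡ (solve 4 (λ p e m e′ → p :* e :* (con 1 :+ m) :* e′ := p :* (con 1 :+ m) :* e′ :* e) refl p e m e′) ⟩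
    t * e′ + p * (1# + m) * e′ * e  ≈⟨ +-congˡ (trans (*-congʳ pe′≈1) (*-identityˡ e)) ⟩
    t * e′ + e                      ∎

module qSeries {c ℓ} (R : CommutativeRing c ℓ) where
  open CommutativeRing R
  open Thm R using (pow; constQ; qmono; 1Q; 0Q; qPoch; invQPoch)
  open PowerSeries R public

  QRing : CommutativeRing c ℓ
  QRing = seriesRing

  module Q = CommutativeRing QRing
  open Thm QRing public using () renaming (pow to powQ)

  q : Series
  q = qmono 1# 1

  qmono-0 : ∀ r → qmono r 0 ≋ constQ r
  qmono-0 r = coeffwise λ where
    zero → refl
    (suc n) → refl

  qmono-cong : ∀ {r s} e → r ≈ s → qmono r e ≋ qmono s e
  qmono-cong {r} {s} e p = coeffwise (go e)
    where
    go : ∀ e n → qmono r e n ≈ qmono s e n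
    go zero zero = p
    go zero (suc n) = refl
    go (suc e) zero = refl
    go (suc e) (suc n) = go e n

  qmono-⊠ : ∀ r s i j → qmono r i ⊠ qmono s j ≋ qmono (r * s) (i ℕ.+ j)
  qmono-⊠ r s zero j = coeffwise (λ n → trans
    (⊠-cong′ (qmono-0 r) (Q.refl {qmono s j}) n)
    (trans (const-⊠ r (qmono s j) n) (go j n)))
    where
    go : ∀ j n → r * qmono s j n ≈ qmono (r * s) j n
    go zero zero = refl
    go zero (suc n) = zeroʳ r
    go (suc j) zero = zeroʳ r
    go (suc j) (suc n) = go j n
  qmono-⊠ r s (suc i) j = coeffwise λ where
    zero → trans (⊠-zero (qmono r (suc i)) (qmono s j)) (zeroˡ _)
    (suc n) → trans (⊠-sucˡ (qmono r (suc i)) (qmono s j) n)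
      (trans (+-cong (zeroˡ _) (coeff (qmono-⊠ r s i j) n)) (+-identityˡ _))

  qmono-pow : ∀ r s n → powQ (qmono r s) n ≋ qmono (pow r n) (s ℕ.* n)
  qmono-pow r s zero =
    Q.trans (Q.sym (qmono-0 1#)) (Q.reflexive (≡.cong (qmono 1#) (≡.sym (ℕₚ.*-zeroʳ s))))
  qmono-pow r s (suc n) =
    Q.trans (Q.*-congˡ {qmono r s} (qmono-pow r s n))
    (Q.trans (qmono-⊠ r (pow r n) s (s ℕ.* n))
      (Q.reflexive (≡.cong (qmono (pow r (suc n))) (≡.sym (ℕₚ.*-suc s n)))))

  q-pow : ∀ n → powQ q n ≋ qmono 1# n
  q-pow n = Q.trans (qmono-pow 1# 1 n)
    (Q.trans (qmono-cong (1 ℕ.* n) (Powers.pow-1# R n))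
      (Q.reflexive (≡.cong (qmono 1#) (ℕₚ.*-identityˡ n))))

  const-pow : ∀ r n → powQ (constQ r) n ≋ constQ (pow r n)
  const-pow r zero = Q.refl
  const-pow r (suc n) = Q.trans (Q.*-congˡ {constQ r} (const-pow r n)) (constQ-* r (pow r n))

  q-pow-const : ∀ r n → powQ q n ⊠ constQ r ≋ qmono r n
  q-pow-const r n =
    Q.trans (Q.*-cong (q-pow n) (Q.sym (qmono-0 r)))
    (Q.trans (qmono-⊠ 1# r n 0)
    (Q.trans (qmono-cong (n ℕ.+ 0) (*-identityˡ r))
      (Q.reflexive (≡.cong (qmono r) (ℕₚ.+-identityʳ n)))))

  neg-monomial : ∀ n → qmono (- 1#) n ⊞ powQ q n ≋ 0Q
  neg-monomial n = Q.trans (Q.+-congˡ {qmono (- 1#) n} (q-pow n)) (coeffwise (go n))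
    where
    go : ∀ n m → qmono (- 1#) n m + qmono 1# n m ≈ 0#
    go zero zero = -‿inverseˡ 1#
    go zero (suc m) = +-identityˡ 0#
    go (suc n) zero = +-identityˡ 0#
    go (suc n) (suc m) = go n m

  qPoch-zero : ∀ n → qPoch n 0 ≈ 1#
  qPoch-zero zero = refl
  qPoch-zero (suc n) = trans (⊠-zero (qPoch n) (1Q ⊞ qmono (- 1#) (suc n)))
    (trans (*-cong (qPoch-zero n) (+-identityʳ 1#)) (*-identityʳ 1#))

  qPoch-inverse : ∀ n → qPoch n ⊠ invQPoch n ≋ 1Q
  qPoch-inverse n = ⊠-invS (qPoch n) 1# (trans (*-identityʳ _) (qPoch-zero n))

  open UnitComplement QRing

  invQPoch-zero : invQPoch 0 ≋ 1Q
  invQPoch-zero = Q.trans (Q.sym (Q.*-identityˡ (invQPoch 0))) (qPoch-inverse 0)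

  open qDifference QRing q using (_hasDifference_; fromCoeffs)

  invQPoch-difference : invQPoch hasDifference invQPoch
  invQPoch-difference = fromCoeffs {g = invQPoch} (λ n →
    inverse-step {p = qPoch n} {e = invQPoch n} (neg-monomial (suc n)) (qPoch-inverse n) (qPoch-inverse (suc n)))

  cancel : ∀ n {a b r} → a ≋ powQ q (suc n) ⊠ a ⊞ r → b ≋ powQ q (suc n) ⊠ b ⊞ r → a ≋ b
  cancel n a-eq b-eq = Q.trans (solve-affine {v = v} (neg-monomial (suc n)) unit a-eq)
    (Q.sym (solve-affine {v = v} (neg-monomial (suc n)) unit b-eq))
    where
    -- The quotient (q;q)ₙ/(q;q)ₙ₊₁ is the inverse of 1-qⁿ⁺¹, obtained from inverses already at
    -- hand.
    v = qPoch n ⊠ invQPoch (suc n)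
    unit : (1Q ⊞ qmono (- 1#) (suc n)) ⊠ v ≋ 1Q
    unit = Q.trans
      (solve 3 (λ u p e → u :* (p :* e) := p :* u :* e) Q.refl
        (1Q ⊞ qmono (- 1#) (suc n)) (qPoch n) (invQPoch (suc n)))
      (qPoch-inverse (suc n))
      where open Algebra.Solver.Ring.NaturalCoefficients.Default Q.commutativeSemiring

-- The infinite product

module Convergence {c ℓ} (R : CommutativeRing c ℓ) where
  open CommutativeRing R hiding (zero)
  open Thm R using (qmono; 0Q)
  open qSeries R
  private module B = PowerSeries QRing

  VanishesBelow : ℕ → Series → Set ℓ
  VanishesBelow K f = ∀ {m} → m < K → f m ≈ 0#

  qmono-vanishes : ∀ r K → VanishesBelow K (qmono r K)
  qmono-vanishes r (suc K) {zero} _ = refl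
  qmono-vanishes r (suc K) {suc m} (s≤s m<K) = qmono-vanishes r K m<K

  ⊠-vanishes : ∀ {K f} g → VanishesBelow K f → VanishesBelow K (f ⊠ g)
  ⊠-vanishes {K} {f} g f≈0 {m} m<K = trans
    (sumTo-cong {g = λ i → 0# * g (m ∸ i)} m (λ i i≤m → *-congʳ (f≈0 (ℕₚ.≤-<-trans i≤m m<K))))
    (0S-⊠ g m)

  sumTo-vanishes : ∀ {K} {F : ℕ → Series} → (∀ i → VanishesBelow K (F i)) →
    ∀ n → VanishesBelow K (B.sumTo F n)
  sumTo-vanishes F≈0 zero _ = refl
  sumTo-vanishes F≈0 (suc n) m<K =
    trans (+-cong (sumTo-vanishes F≈0 n m<K) (F≈0 n m<K)) (+-identityˡ 0#)

  -- The hypotheses say H ≡ 1 modulo q^K, so multiplication by H leaves every coefficient of qᵐ with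
  -- m < K unchanged, whatever the power of u.
  coeff-limit : ∀ {K m} P H → H 0 ≋ Q.1# → (∀ i → VanishesBelow K (H (suc i))) → m < K →
    ∀ n → (P B.⊠ H) n m ≈ P n m
  coeff-limit {K} {m} P H H₀≋1 H≈0 m<K zero = coeff (Q.trans (B.⊠-zero P H)
    (Q.trans (Q.*-congˡ {P 0} H₀≋1) (Q.*-identityʳ (P 0)))) m
  coeff-limit {K} {m} P H H₀≋1 H≈0 m<K (suc n) = begin
    (P B.⊠ H) (suc n) m
      ≈⟨ coeff (Q.trans (B.⊠-comm P H (suc n)) (B.⊠-sucˡ H P n)) m ⟩
    (H 0 ⊠ P (suc n)) m + (B.shift H B.⊠ P) n m
      ≈⟨ +-cong (coeff (Q.trans (Q.*-congʳ {P (suc n)} H₀≋1) (Q.*-identityˡ (P (suc n)))) m)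
                (sumTo-vanishes (λ i → ⊠-vanishes (P (n ∸ i)) (H≈0 i)) (suc n) m<K) ⟩
    P (suc n) m + 0#
      ≈⟨ +-identityʳ _ ⟩
    P (suc n) m ∎
    where open Relation.Binary.Reasoning.Setoid setoid

-- Telescoping of the factors over R[[q]][[u]].

module InfiniteProduct {c ℓ} (R : CommutativeRing c ℓ)
  (x y z β xinv dinv : CommutativeRing.Carrier R)
  (x-inverse : CommutativeRing._≈_ R (CommutativeRing._*_ R x xinv) (CommutativeRing.1# R))
  (d-inverse : CommutativeRing._≈_ R
    (CommutativeRing._*_ R (CommutativeRing._+_ R x (CommutativeRing.-_ R y)) dinv)
    (CommutativeRing.1# R))
  where
  open CommutativeRing R hiding (zero)
  open qSeries R
  open Thm R
    using (pow; constQ; qmono; 1Q; 0Q; qPoch; invQPoch; constB; 1B; umono; weight; Finv; LHS)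
  open Thm QRing using () renaming (constQ to constU)
  open PowerSeries QRing using () renaming
    (seriesRing to URing; Series to BSeries; _⊞_ to _⊞ᵁ_; _⊠_ to _⊠ᵁ_; ⊟_ to ⊟ᵁ_; _≋_ to _≋ᵁ_;
     coeffwise to coeffwiseᵁ; coeff to coeffᵁ; const-⊠ to constU-⊠; constQ-* to constU-*;
     constQ-+ to constU-+; constQ-cong to constU-cong; ⊠-invS to ⊠-invSᵁ; ⊠-zero to ⊠-zeroᵁ;
     invS to invSᵁ)
  open Rescaling QRing
  open qDifference QRing q using (η; _hasDifference_)
  open CommutativeRingIdentities URing
  private module U = CommutativeRing URing

  xᵠ yᵠ pᵠ sᵠ tᵠ zᵠ βᵠ : Series
  xᵠ = constQ x
  yᵠ = constQ y
  pᵠ = constQ (x + - y)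
  sᵠ = constQ (z + - y)
  tᵠ = constQ (x + - z)
  zᵠ = constQ z
  βᵠ = constQ β

  const-+- : ∀ a b → constQ b ⊞ constQ (a + - b) ≋ constQ a
  const-+- a b = Q.trans (constQ-+ b (a + - b)) (constQ-cong (begin
    b + (a + - b)  ≈⟨ +-congˡ (+-comm a (- b)) ⟩
    b + (- b + a)  ≈⟨ +-assoc b (- b) a ⟨
    b + - b + a    ≈⟨ +-congʳ (-‿inverseʳ b) ⟩
    0# + a         ≈⟨ +-identityˡ a ⟩
    a              ∎))
    where open Relation.Binary.Reasoning.Setoid setoid

  open GeneratingSeries QRing q cancel invQPoch invQPoch-zero invQPoch-difference
  open Weights QRing q xᵠ yᵠ using (statWeight; permSum)

  C G : BSeries
  C = eulerianSeries (const-+- x y)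
  G = statSeries (const-+- x y) zᵠ βᵠ

  -- `weight` is one monomial in q, while `statWeight` is a product in R[[q]] with constants for x,
  -- y, z, β. The combinatorics is done for the latter form, over any commutative ring with a chosen
  -- element `q`.
  weight≋statWeight : ∀ σ → weight x y z β σ ≋ statWeight zᵠ βᵠ σ
  weight≋statWeight σ = Q.sym (Q.trans
    (Q.*-congˡ {powQ q (inv σ)} monomial)
    (q-pow-const _ (inv σ)))
    where
    i = iasc σ
    j = isol σ
    d = des σ ∸ 1
    k = RLmin σ
    monomial : powQ xᵠ i ⊠ powQ zᵠ j ⊠ powQ yᵠ d ⊠ powQ βᵠ k ≋ constQ (pow x i * pow z j * pow y d * pow β k)
    monomial =
      Q.trans (Q.*-cong (Q.*-cong (Q.*-cong (const-pow x i) (const-pow z j)) (const-pow y d)) (const-pow β k))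
      (Q.trans (Q.*-congʳ {constQ (pow β k)} (Q.trans
          (Q.*-congʳ {constQ (pow y d)} (constQ-* (pow x i) (pow z j)))
          (constQ-* (pow x i * pow z j) (pow y d))))
        (constQ-* (pow x i * pow z j * pow y d) (pow β k)))

  Finv≋permSum : ∀ n → Finv x y z β n ≋ permSum (statWeight zᵠ βᵠ) n
  Finv≋permSum zero = Q.sym (Q.trans (Q.+-identityʳ _)
    (solve 0 (con 1 :* (con 1 :* con 1 :* con 1 :* con 1) := con 1) Q.refl))
    where open Algebra.Solver.Ring.NaturalCoefficients.Default Q.commutativeSemiring
  Finv≋permSum (suc n) = go (perms (suc n))
    where
    go : ∀ L → foldr (λ σ acc → weight x y z β σ ⊞ acc) 0Q L
             ≋ foldr (λ σ acc → statWeight zᵠ βᵠ σ ⊞ acc) 0Q L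
    go [] = Q.refl
    go (σ ∷ L) = Q.+-cong (weight≋statWeight σ) (go L)

  LHS≋G : LHS x y z β ≋ᵁ G
  LHS≋G = coeffwiseᵁ (λ n → Q.*-congʳ {invQPoch n} (Finv≋permSum n))

  κ : Carrier → BSeries
  κ r = constU (constQ r)

  κ-* : ∀ r s → κ r ⊠ᵁ κ s ≋ᵁ κ (r * s)
  κ-* r s = U.trans (constU-* (constQ r) (constQ s)) (constU-cong (constQ-* r s))

  κ-cong : ∀ {r s} → r ≈ s → κ r ≋ᵁ κ s
  κ-cong p = constU-cong (constQ-cong p)

  constB≋κ : ∀ r → constB r ≋ᵁ κ r
  constB≋κ r = coeffwiseᵁ λ where
    zero → Q.refl
    (suc n) → Q.refl

  -- f(uqᵏ)
  _at_ : BSeries → ℕ → BSeries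
  f at k = scale (powQ q k) f

  at-suc : ∀ f k → f at suc k ≋ᵁ η f at k
  at-suc f k = U.sym (U.trans (scale-scale (powQ q k) q f) (scale-cong (Q.*-comm (powQ q k) q) (U.refl {f})))

  umono≋ : ∀ r k → umono r k ≋ᵁ κ r ⊠ᵁ (var at k)
  umono≋ r k = coeffwiseᵁ λ where
      zero → zero-coeff zero Q.refl
      (suc zero) → Q.sym (Q.trans (constU-⊠ (constQ r) (var at k) 1)
        (Q.trans (Q.*-congˡ {constQ r} (Q.trans (Q.*-identityʳ (powQ (powQ q k) 1)) (Q.*-identityʳ (powQ q k))))
        (Q.trans (Q.*-comm (constQ r) (powQ q k)) (q-pow-const r k))))
      (suc (suc n)) → zero-coeff (suc (suc n)) Q.refl
    where
    zero-coeff : ∀ n → var n ≋ 0Q → 0Q ≋ (κ r ⊠ᵁ (var at k)) n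
    zero-coeff n eq = Q.sym (Q.trans (constU-⊠ (constQ r) (var at k) n)
      (Q.trans (Q.*-congˡ {constQ r} (Q.trans (Q.*-congˡ {powQ (powQ q k) n} eq)
        (Q.zeroʳ (powQ (powQ q k) n)))) (Q.zeroʳ (constQ r))))

  module T = Thm R
  E Num Den factor prodTo : ℕ → BSeries
  E = T.E x y z β xinv dinv
  Num = T.Num x y z β xinv dinv
  Den = T.Den x y z β xinv dinv
  factor = T.factor x y z β xinv dinv
  prodTo = T.prodTo x y z β xinv dinv

  E≋ : ∀ k → E k ≋ᵁ scale pᵠ invQPoch at suc k
  E≋ k = coeffwiseᵁ (λ n → Q.trans
    (Q.*-congʳ {invQPoch n} (begin
      qmono (pow p n) (suc k ℕ.* n)       ≈⟨ qmono-pow p (suc k) n ⟨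
      powQ (qmono p (suc k)) n            ≈⟨ QPow.pow-cong n (q-pow-const p (suc k)) ⟨
      powQ (powQ q (suc k) ⊠ pᵠ) n        ≈⟨ QPow.pow-* (powQ q (suc k)) pᵠ n ⟩
      powQ (powQ q (suc k)) n ⊠ powQ pᵠ n ∎))
    (Q.*-assoc (powQ (powQ q (suc k)) n) (powQ pᵠ n) (invQPoch n)))
    where
    p = x + - y
    module QPow = Powers QRing
    open Relation.Binary.Reasoning.Setoid Q.setoid

  module _ (k : ℕ) where
    private
      K = powQ q k
      p = x + - y
      Ê = scale pᵠ invQPoch

    closed-form-at : C at k ≋ᵁ constB (xinv * y) ⊠ᵁ ((Ê at k) ⊠ᵁ ((C at k) ⊞ᵁ κ p))
    closed-form-at = begin
      C at k
        ≈⟨ U.*-identityˡ (C at k) ⟨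
      κ 1# ⊠ᵁ (C at k)
        ≈⟨ U.*-congʳ {C at k} (U.trans (κ-* xinv x) (κ-cong (trans (*-comm xinv x) x-inverse))) ⟨
      κ xinv ⊠ᵁ κ x ⊠ᵁ (C at k)
        ≈⟨ U.*-assoc (κ xinv) (κ x) (C at k) ⟩
      κ xinv ⊠ᵁ (κ x ⊠ᵁ (C at k))
        ≈⟨ U.*-congˡ {κ xinv} (U.trans (scale-⊠ K (κ x) C) (U.*-congʳ {C at k} (scale-const K xᵠ))) ⟨
      κ xinv ⊠ᵁ ((κ x ⊠ᵁ C) at k)
        ≈⟨ U.*-congˡ {κ xinv} (scale-cong {K} Q.refl (eulerianSeries-closed-form (const-+- x y))) ⟩
      κ xinv ⊠ᵁ ((κ y ⊠ᵁ (Ê ⊠ᵁ (C ⊞ᵁ κ p))) at k)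
        ≈⟨ U.*-congˡ {κ xinv} (U.trans (scale-⊠ K (κ y) (Ê ⊠ᵁ (C ⊞ᵁ κ p)))
             (U.*-cong (scale-const K yᵠ) (U.trans (scale-⊠ K Ê (C ⊞ᵁ κ p))
               (U.*-congˡ {Ê at k} (U.trans (scale-⊞ K C (κ p)) (U.+-congˡ {C at k} (scale-const K pᵠ))))))) ⟩
      κ xinv ⊠ᵁ (κ y ⊠ᵁ ((Ê at k) ⊠ᵁ ((C at k) ⊞ᵁ κ p)))
        ≈⟨ U.*-assoc (κ xinv) (κ y) ((Ê at k) ⊠ᵁ ((C at k) ⊞ᵁ κ p)) ⟨
      κ xinv ⊠ᵁ κ y ⊠ᵁ ((Ê at k) ⊠ᵁ ((C at k) ⊞ᵁ κ p))
        ≈⟨ U.*-congʳ {(Ê at k) ⊠ᵁ ((C at k) ⊞ᵁ κ p)} (U.trans (κ-* xinv y) (U.sym (constB≋κ (xinv * y)))) ⟩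
      constB (xinv * y) ⊠ᵁ ((Ê at k) ⊠ᵁ ((C at k) ⊞ᵁ κ p)) ∎
      where open Relation.Binary.Reasoning.Setoid U.setoid

    difference-at : G at k ≋ᵁ
      (G at suc k) ⊞ᵁ (var at k) ⊠ᵁ (κ β ⊠ᵁ (((C at suc k) ⊞ᵁ κ (z + - y)) ⊠ᵁ (G at k)))
    difference-at = begin
      G at k
        ≈⟨ scale-cong {K} Q.refl (statSeries-difference (const-+- x y) zᵠ βᵠ (const-+- z y)) ⟩
      (η G ⊞ᵁ (var ⊠ᵁ (κ β ⊠ᵁ (A ⊠ᵁ G)))) at k
        ≈⟨ scale-⊞ K (η G) (var ⊠ᵁ (κ β ⊠ᵁ (A ⊠ᵁ G))) ⟩
      (η G at k) ⊞ᵁ ((var ⊠ᵁ (κ β ⊠ᵁ (A ⊠ᵁ G))) at k)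
        ≈⟨ U.+-cong (U.sym (at-suc G k))
             (U.trans (scale-⊠ K var (κ β ⊠ᵁ (A ⊠ᵁ G))) (U.*-congˡ {var at k}
             (U.trans (scale-⊠ K (κ β) (A ⊠ᵁ G)) (U.*-cong (scale-const K βᵠ)
             (U.trans (scale-⊠ K A G) (U.*-congʳ {G at k}
             (U.trans (scale-⊞ K (η C) (κ (z + - y))) (U.+-cong (U.sym (at-suc C k)) (scale-const K sᵠ))))))))) ⟩
      (G at suc k) ⊞ᵁ (var at k) ⊠ᵁ (κ β ⊠ᵁ (((C at suc k) ⊞ᵁ κ (z + - y)) ⊠ᵁ (G at k))) ∎
      where
      A = η C ⊞ᵁ κ (z + - y)
      open Relation.Binary.Reasoning.Setoid U.setoid

  module _ (k : ℕ) where

    Num-complement : Num k ⊞ᵁ constB (xinv * y) ⊠ᵁ E k ≋ᵁ U.1#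
    Num-complement = U.trans (U.+-assoc 1B (⊟ᵁ w) w)
      (U.trans (U.+-cong (constB≋κ 1#) (U.-‿inverseˡ w)) (U.+-identityʳ U.1#))
      where w = constB (xinv * y) ⊠ᵁ E k

    umono-* : ∀ r → umono (β * r) k ≋ᵁ κ β ⊠ᵁ κ r ⊠ᵁ (var at k)
    umono-* r = U.trans (umono≋ (β * r) k) (U.*-congʳ {var at k} (U.sym (κ-* β r)))

    Den-complement : Den k ⊞ᵁ (κ β ⊠ᵁ κ (z + - y) ⊠ᵁ (var at k) ⊞ᵁ
      constB (xinv * y) ⊠ᵁ (U.1# ⊞ᵁ κ β ⊠ᵁ κ (x + - z) ⊠ᵁ (var at k)) ⊠ᵁ E k) ≋ᵁ U.1#
    Den-complement = begin
      (1B ⊞ᵁ ⊟ᵁ a ⊞ᵁ ⊟ᵁ b) ⊞ᵁ (a′ ⊞ᵁ b′)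
        ≈⟨ U.+-congˡ {1B ⊞ᵁ ⊟ᵁ a ⊞ᵁ ⊟ᵁ b} (U.+-cong a≋ b≋) ⟨
      (1B ⊞ᵁ ⊟ᵁ a ⊞ᵁ ⊟ᵁ b) ⊞ᵁ (a ⊞ᵁ b)
        ≈⟨ solve 5 (λ o na nb a b → o :+ na :+ nb :+ (a :+ b) := o :+ ((na :+ a) :+ (nb :+ b))) U.refl
             1B (⊟ᵁ a) (⊟ᵁ b) a b ⟩
      1B ⊞ᵁ ((⊟ᵁ a ⊞ᵁ a) ⊞ᵁ (⊟ᵁ b ⊞ᵁ b))
        ≈⟨ U.+-cong (constB≋κ 1#) (U.trans (U.+-cong (U.-‿inverseˡ a) (U.-‿inverseˡ b)) (U.+-identityˡ U.0#)) ⟩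
      U.1# ⊞ᵁ U.0#
        ≈⟨ U.+-identityʳ U.1# ⟩
      U.1# ∎
      where
      open Relation.Binary.Reasoning.Setoid U.setoid
      open Algebra.Solver.Ring.NaturalCoefficients.Default U.commutativeSemiring using (solve; _:+_; _:=_)
      a = umono (β * (z + - y)) k
      b = (constB (xinv * y) ⊠ᵁ (1B ⊞ᵁ umono (β * (x + - z)) k)) ⊠ᵁ E k
      a′ = κ β ⊠ᵁ κ (z + - y) ⊠ᵁ (var at k)
      b′ = constB (xinv * y) ⊠ᵁ (U.1# ⊞ᵁ κ β ⊠ᵁ κ (x + - z) ⊠ᵁ (var at k)) ⊠ᵁ E k
      a≋ : a ≋ᵁ a′
      a≋ = umono-* (z + - y)
      b≋ : b ≋ᵁ b′
      b≋ = U.*-congʳ {E k} (U.*-congˡ {constB (xinv * y)} (U.+-cong (constB≋κ 1#) (umono-* (x + - z))))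

    Den-G : Den k ⊠ᵁ (G at k) ≋ᵁ Num k ⊠ᵁ (G at suc k)
    Den-G = functional-equation
      (U.trans (constU-+ sᵠ tᵠ) (constU-cong (Q.trans (constQ-+ (z + - y) (x + - z)) (constQ-cong telescope))))
      -- The closed form is taken at uq^(k+1), the argument of the exponential `E k`, while the
      -- equation for G relates uq^k to uq^(k+1).
      (U.trans (closed-form-at (suc k)) (U.*-congˡ {constB (xinv * y)}
        (U.*-congʳ {(C at suc k) ⊞ᵁ κ (x + - y)} (U.sym (E≋ k)))))
      (difference-at k)
      Num-complement
      Den-complement
      where
      telescope : (z + - y) + (x + - z) ≈ x + - y
      telescope = begin
        (z + - y) + (x + - z)
          ≈⟨ solve 4 (λ z y x z′ → (z :+ y) :+ (x :+ z′) := (x :+ y) :+ (z :+ z′)) refl z (- y) x (- z) ⟩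
        (x + - y) + (z + - z)  ≈⟨ +-congˡ (-‿inverseʳ z) ⟩
        (x + - y) + 0#         ≈⟨ +-identityʳ _ ⟩
        x + - y                ∎
        where
        open Relation.Binary.Reasoning.Setoid setoid
        open Algebra.Solver.Ring.NaturalCoefficients.Default commutativeSemiring using (solve; _:+_; _:=_)

    E-zero : E k 0 ≋ 1Q
    E-zero = Q.trans (coeffᵁ (E≋ k) 0)
      (Q.trans (Q.*-identityˡ _) (Q.trans (Q.*-identityˡ (invQPoch 0)) invQPoch-zero))

    ⊠ᵁ-zero-zero : ∀ F H → (F ⊠ᵁ H) 0 0 ≈ F 0 0 * H 0 0
    ⊠ᵁ-zero-zero F H = trans (coeff (⊠-zeroᵁ F H) 0) (⊠-zero (F 0) (H 0))

    Den-zero-zero : Den k 0 0 ≈ 1# + - (xinv * y)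
    Den-zero-zero = begin
      1# + - 0# + - (F ⊠ᵁ E k) 0 0
        ≈⟨ +-cong (trans (+-congˡ -0#≈0#) (+-identityʳ 1#)) (-‿cong (⊠ᵁ-zero-zero F (E k))) ⟩
      1# + - (F 0 0 * E k 0 0)
        ≈⟨ +-congˡ (-‿cong (*-cong (⊠ᵁ-zero-zero (constB (xinv * y)) (1B ⊞ᵁ umono (β * (x + - z)) k)) (coeff E-zero 0))) ⟩
      1# + - (xinv * y * (1# + 0#) * 1#)
        ≈⟨ +-congˡ (-‿cong (trans (*-identityʳ _) (trans (*-congˡ (+-identityʳ 1#)) (*-identityʳ _)))) ⟩
      1# + - (xinv * y) ∎
      where
      F = constB (xinv * y) ⊠ᵁ (1B ⊞ᵁ umono (β * (x + - z)) k)
      open Relation.Binary.Reasoning.Setoid setoid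
      open Algebra.Properties.Ring ring using (-0#≈0#)

    -- (1 - y/x) · x/(x-y) = 1. The inverse of `Den k` is built in two stages, first of its constant
    -- term in u within R[[q]] and then in u, so only this lowest coefficient needs an inverse in R.
    Den-invertible : Den k 0 0 * (x * dinv) ≈ 1#
    Den-invertible = begin
      Den k 0 0 * (x * dinv)                ≈⟨ *-congʳ Den-zero-zero ⟩
      (1# + - (xinv * y)) * (x * dinv)      ≈⟨ *-assoc _ _ _ ⟨
      (1# + - (xinv * y)) * x * dinv        ≈⟨ *-congʳ (distribʳ x 1# _) ⟩
      (1# * x + - (xinv * y) * x) * dinv    ≈⟨ *-congʳ (+-cong (*-identityˡ x) (sym (-‿distribˡ-* (xinv * y) x))) ⟩
      (x + - (xinv * y * x)) * dinv         ≈⟨ *-congʳ (+-congˡ (-‿cong (solve 3 (λ i y x → i :* y :* x := x :* i :* y) refl xinv y x))) ⟩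
      (x + - (x * xinv * y)) * dinv         ≈⟨ *-congʳ (+-congˡ (-‿cong (trans (*-congʳ x-inverse) (*-identityˡ y)))) ⟩
      (x + - y) * dinv                      ≈⟨ d-inverse ⟩
      1#                                    ∎
      where
      open Relation.Binary.Reasoning.Setoid setoid
      open Algebra.Properties.Ring ring using (-‿distribˡ-*)
      open Algebra.Solver.Ring.NaturalCoefficients.Default commutativeSemiring using (solve; _:*_; _:=_)

    factor-G : factor k ⊠ᵁ (G at suc k) ≋ᵁ G at k
    factor-G = begin
      Num k ⊠ᵁ I ⊠ᵁ (G at suc k)   ≈⟨ solve 3 (λ n i g → n :* i :* g := i :* (n :* g)) U.refl (Num k) I (G at suc k) ⟩
      I ⊠ᵁ (Num k ⊠ᵁ (G at suc k)) ≈⟨ U.*-congˡ {I} Den-G ⟨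
      I ⊠ᵁ (Den k ⊠ᵁ (G at k))     ≈⟨ solve 3 (λ d i g → i :* (d :* g) := d :* i :* g) U.refl (Den k) I (G at k) ⟩
      Den k ⊠ᵁ I ⊠ᵁ (G at k)       ≈⟨ U.*-congʳ {G at k} (⊠-invSᵁ (Den k) c₀ (⊠-invS (Den k 0) (x * dinv) Den-invertible)) ⟩
      U.1# ⊠ᵁ (G at k)             ≈⟨ U.*-identityˡ (G at k) ⟩
      G at k                       ∎
      where
      c₀ = invS (Den k 0) (x * dinv)
      I = invSᵁ (Den k) c₀
      open Relation.Binary.Reasoning.Setoid U.setoid
      open Algebra.Solver.Ring.NaturalCoefficients.Default U.commutativeSemiring using (solve; _:*_; _:=_)

  prodTo-G : ∀ K → prodTo K ⊠ᵁ (G at K) ≋ᵁ G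
  prodTo-G zero = U.trans (U.*-cong (constB≋κ 1#) (scale-1# G)) (U.*-identityˡ G)
  prodTo-G (suc K) = U.trans (U.*-assoc (prodTo K) (factor K) (G at suc K))
    (U.trans (U.*-congˡ {prodTo K} (factor-G K)) (prodTo-G K))

  open Convergence R

  prodTo-coeff : ∀ n m K → m < K → prodTo K n m ≈ LHS x y z β n m
  prodTo-coeff n m K m<K = begin
    prodTo K n m                  ≈⟨ coeff-limit (prodTo K) (G at K) G-zero G-vanishes m<K n ⟨
    (prodTo K ⊠ᵁ (G at K)) n m    ≈⟨ coeff (coeffᵁ (prodTo-G K) n) m ⟩
    G n m                         ≈⟨ coeff (coeffᵁ LHS≋G n) m ⟨
    LHS x y z β n m               ∎
    where
    open Relation.Binary.Reasoning.Setoid setoid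
    G-zero : (G at K) 0 ≋ 1Q
    G-zero = Q.trans (Q.*-identityˡ (G 0)) (statSeries-zero (const-+- x y) zᵠ βᵠ)
    G-vanishes : ∀ i → VanishesBelow K ((G at K) (suc i))
    -- The coefficient of uⁱ⁺¹ in G(uq^K) carries q^(K(i+1)); splitting off a single factor q^K is
    -- enough.
    G-vanishes i {j} j<K = trans
      (coeff (Q.trans (Q.*-assoc (powQ q K) (powQ (powQ q K) i) (G (suc i)))
                      (Q.*-congʳ {powQ (powQ q K) i ⊠ G (suc i)} (q-pow K))) j)
      (⊠-vanishes (powQ (powQ q K) i ⊠ G (suc i)) (qmono-vanishes 1# K) j<K)

theorem5p2 : ∀ {c ℓ} (R : CommutativeRing c ℓ) →
    let open CommutativeRing R in
    (x y z β xinv dinv : Carrier) →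
    x * xinv ≈ 1# → (x + - y) * dinv ≈ 1# →
    ∀ (n m : ℕ) → ∃[ K ] (∀ (K′ : ℕ) → K ≤ K′ →
    Thm.prodTo R x y z β xinv dinv K′ n m ≈ Thm.LHS R x y z β n m)
theorem5p2 R x y z β xinv dinv x-inverse d-inverse n m =
  -- The threshold depends on `m` alone: G(uq^K) ≡ 1 modulo q^K holds for all powers of u at once,
  -- and K > m suffices.
  suc m , λ K m<K → InfiniteProduct.prodTo-coeff R x y z β xinv dinv x-inverse d-inverse n m K m<K
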